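{- Let $\mathcal P$ be a collection of homogeneous graph properties, let $f_1,\dots,f_s$ be additive functions on graphs, and let $\omega=(\omega_1,\omega_2,\dots)\in\mathbb Q^{\infty}$ be a weight vector. For $n\ge 1$ and integers $k_1,\dots,k_s$ let $g_{n,k_1,\dots,k_s}$ be the number of connected graphs $G$ on the vertex set $[n]=\{1,\dots,n\}$ that satisfy the properties $\mathcal P$ and have $f_i(G)=k_i$ for $i=1,\dots,s$. Put $$\tilde g(x,y,z)=\sum_{n\ge 1,\;k_1,\dots,k_s} g_{n,k_1,\dots,k_s}\,\frac{1}{n!}\,x^n\prod_{i=1}^s y_i^{k_i}\,z_n ,$$ a formal series in $x$, $y_1,\dots,y_s$ and infinitely many variables $z_1,z_2,\dots$. Then the number of graphs with properties $\mathcal P$, of given order, given values of the $f_i$ and given $\omega$-weighted number of connected components $h_0^\omega$ is generated by $\tau_\omega(\exp\tilde g)$. That is, if $$\tau_\omega(\exp\tilde g)=\sum_{n,k,\nu} T_{n,k,\nu}\,\frac{1}{n!}\,x^n y^k z^\nu,\qquad k=(k_1,\dots,k_s),\quad y^k=\prod_{i=1}^s y_i^{k_i},$$ then $T_{n,k,\nu}$ is precisely the number of graphs $G$ on $[n]$ with properties $\mathcal P$, with $f_i(G)=k_i$ for all $i=1,\dots,s$, and with $h_0^\omega(G)=\nu$.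
   Context: All graphs are finite, simple and labeled. The order of a graph is its number of vertices; $|G|$ denotes the order of $G$. Graph properties and functions on graphs are understood to be invariant under relabeling of vertices. An integer-valued function $f$ on the set of graphs is additive if $f(G+G')=f(G)+f(G')$ for any two graphs $G,G'$ with disjoint vertex sets, where $G+G'$ is the disjoint union. A graph property $P$ is homogeneous if, whenever a graph $G$ satisfies $P$, all of the connected components of $G$ satisfy $P$. The $\omega$-weighted number of connected components of a graph $G$ with connected components $G_1,\dots,G_r$ is $h_0^\omega(G)=\sum_{i=1}^r\omega_{|G_i|}$. In particular, for $\omega=(1,1,1,\dots)$ it is the number of connected components. The graph with no vertices ($n=0$) is counted once by convention, with all $f_i$ equal to $0$, with $h_0^\omega=0$, and as satisfying all the properties; it corresponds to the constant term $1$. $\tau_\omega:\mathbb Q[z_1,z_2,\dots]\to\overline{\mathbb Q(z)}$ is the ring homomorphism determined by $\prod_i z_i^{\alpha_i}\mapsto z^{\sum_i\omega_i\alpha_i}$ (so $z_i\mapsto z^{\omega_i}$), where $\overline{\mathbb Q(z)}$ is the algebraic closure of the function field $\mathbb Q(z)$, and computations with fractional powers of $z$ are done purely symbolically. It is extended by replacing the coefficient ring $\mathbb Q$ with $\mathbb Q[x,y_1,\dots,y_s]$, so that it fixes $x$ and the $y_i$, and it is applied coefficientwise to formal power series in $x$.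
   Formalization: Homogeneous is taken as "G satisfies P if and only if all its connected components do": with only the one-way implication the claim fails (P = connected, n = 2). It is also assumed decidable whether a graph satisfies the properties, which is automatic classically. -}

module Defs where

open import Algebra.Core using (Op₂)
open import Data.Bool.Base using (Bool; true; false; T)
open import Data.Bool.Properties using (T?) renaming (_≟_ to _≟ᵇ_)
open import Data.Fin.Base using (Fin; zero; suc; splitAt)
open import Data.Fin.Properties using (all?) renaming (_≟_ to _≟ᶠ_)
open import Data.Fin.Subset using (Subset; inside; outside; ∣_∣)
open import Data.Integer.Base as ℤ using (ℤ; +_)
import Data.Integer.Properties as ℤ
open import Data.List.Base as List using
  (List; []; _∷_; [_]; _++_; map; filter; length; foldr; concat; replicate; upTo; allFin;
   cartesianProductWith; deduplicate)
open import Data.List.Membership.Propositional using (_∈_)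
open import Data.List.Membership.Propositional.Properties using (∈-allFin)
open import Data.List.Relation.Unary.All using (All; []; _∷_)
open import Data.List.Relation.Unary.AllPairs using ([]; _∷_)
open import Data.List.Relation.Unary.Any using (Any; here; there)
import Data.List.Relation.Unary.Any.Properties as Any
import Data.List.Relation.Unary.Unique.Setoid as Unique
import Data.List.Relation.Unary.Unique.Setoid.Properties as Unique
open import Data.Nat.Base as ℕ using (ℕ; zero; suc; NonZero; _!)
open import Data.Nat.Properties using (_!≢0)
import Data.Nat.Properties as ℕ
open import Data.Product.Base using (∃; _×_; _,_; proj₁; proj₂; uncurry)
import Data.Product.Properties as Product
open import Data.Rational.Base as ℚ using (ℚ; 0ℚ; 1ℚ)
import Data.Rational.Properties as ℚ
open import Data.Sum.Base using (_⊎_; inj₁; inj₂)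
open import Data.Vec.Base as Vec using (Vec; []; _∷_; lookup; tabulate; zipWith)
import Data.Vec.Properties as Vec
open import Function.Base using (_∘_)
open import Function.Bundles using (_⇔_; _↔_; Inverse)
open import Level using (Level; 0ℓ; _⊔_) renaming (suc to lsuc)
open import Relation.Binary.Bundles using (Setoid)
open import Relation.Binary.Construct.Closure.ReflexiveTransitive using (Star; ε; _◅_; _◅◅_)
open import Relation.Binary.Definitions using (DecidableEquality)
open import Relation.Binary.PropositionalEquality using
  (_≡_; _≢_; refl; sym; trans; cong; cong₂)
import Relation.Binary.PropositionalEquality.Properties as ≡
open import Relation.Nullary.Decidable using (Dec; does; map′; _⊎-dec_; _×-dec_)
open import Relation.Unary using (Pred; Decidable)

private
  variable
    ι ℓ : Level
    m n s : ℕ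

------------------------------------------------------------------------
-- Graphs

record Graph (n : ℕ) : Set where
  field
    adj        : Fin n → Fin n → Bool
    adj-sym    : ∀ u v → adj u v ≡ adj v u
    adj-irrefl : ∀ v → adj v v ≡ false

open Graph public

-- Equality of labeled graphs; propositional equality of the records would need
-- function extensionality.

infix 4 _≈ᴳ_

_≈ᴳ_ : Graph n → Graph n → Set
G ≈ᴳ H = ∀ u v → adj G u v ≡ adj H u v

graphSetoid : ℕ → Setoid 0ℓ 0ℓ
graphSetoid n = record
  { Carrier       = Graph n
  ; _≈_           = _≈ᴳ_
  ; isEquivalence = record
    { refl  = λ u v → refl
    ; sym   = λ p u v → sym (p u v)
    ; trans = λ p q u v → trans (p u v) (q u v)
    }
  }

infix 4 _≅_

_≅_ : Graph m → Graph n → Set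
_≅_ {m} {n} G H = ∃ λ (π : Fin m ↔ Fin n) →
  ∀ u v → adj G u v ≡ adj H (Inverse.to π u) (Inverse.to π v)

infixr 6 _⊕_

_⊕_ : Graph m → Graph n → Graph (m ℕ.+ n)
_⊕_ {m} {n} G H = record
  { adj        = λ u v → a (splitAt m u) (splitAt m v)
  ; adj-sym    = λ u v → a-sym (splitAt m u) (splitAt m v)
  ; adj-irrefl = λ v → a-irrefl (splitAt m v)
  }
  where
  a : Fin m ⊎ Fin n → Fin m ⊎ Fin n → Bool
  a (inj₁ u) (inj₁ v) = adj G u v
  a (inj₂ u) (inj₂ v) = adj H u v
  a (inj₁ _) (inj₂ _) = false
  a (inj₂ _) (inj₁ _) = false

  a-sym : ∀ x y → a x y ≡ a y x
  a-sym (inj₁ u) (inj₁ v) = adj-sym G u v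
  a-sym (inj₂ u) (inj₂ v) = adj-sym H u v
  a-sym (inj₁ _) (inj₂ _) = refl
  a-sym (inj₂ _) (inj₁ _) = refl

  a-irrefl : ∀ x → a x x ≡ false
  a-irrefl (inj₁ v) = adj-irrefl G v
  a-irrefl (inj₂ v) = adj-irrefl H v

------------------------------------------------------------------------
-- Connectedness and connected components

Reachable : Graph n → Fin n → Fin n → Set
Reachable G = Star (λ u v → T (adj G u v))

-- There is a path whose interior vertices all lie in the given list.

private
  module _ (G : Graph n) where

    Via : List (Fin n) → Fin n → Fin n → Set
    Via []       u v = u ≡ v ⊎ T (adj G u v)
    Via (w ∷ ws) u v = Via ws u v ⊎ (Via ws u w × Via ws w v)

    via? : ∀ ws u v → Dec (Via ws u v)
    via? []       u v = (u ≟ᶠ v) ⊎-dec T? (adj G u v)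
    via? (w ∷ ws) u v = via? ws u v ⊎-dec (via? ws u w ×-dec via? ws w v)

    via-base : ∀ ws {u v} → Via [] u v → Via ws u v
    via-base []       p = p
    via-base (w ∷ ws) p = inj₁ (via-base ws p)

    via-trans : ∀ {ws w} → w ∈ ws → ∀ {u v} → Via ws u w → Via ws w v → Via ws u v
    via-trans {x ∷ ws} (here refl) p q = inj₂ (to p , from q)
      where
      to : ∀ {u} → Via (x ∷ ws) u x → Via ws u x
      to (inj₁ r)       = r
      to (inj₂ (r , _)) = r
      from : ∀ {v} → Via (x ∷ ws) x v → Via ws x v
      from (inj₁ r)       = r
      from (inj₂ (_ , r)) = r
    via-trans (there i) (inj₁ p)       (inj₁ q)       = inj₁ (via-trans i p q)
    via-trans (there i) (inj₁ p)       (inj₂ (q , r)) = inj₂ (via-trans i p q , r)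
    via-trans (there i) (inj₂ (p , q)) (inj₁ r)       = inj₂ (p , via-trans i q r)
    via-trans (there i) (inj₂ (p , _)) (inj₂ (_ , r)) = inj₂ (p , r)

    via-sound : ∀ ws {u v} → Via ws u v → Reachable G u v
    via-sound []       (inj₁ refl)    = ε
    via-sound []       (inj₂ e)       = e ◅ ε
    via-sound (w ∷ ws) (inj₁ p)       = via-sound ws p
    via-sound (w ∷ ws) (inj₂ (p , q)) = via-sound ws p ◅◅ via-sound ws q

    via-complete : ∀ {u v} → Reachable G u v → Via (allFin n) u v
    via-complete ε       = via-base (allFin n) (inj₁ refl)
    via-complete (e ◅ p) =
      via-trans (∈-allFin _) (via-base (allFin n) (inj₂ e)) (via-complete p)

reachable? : (G : Graph n) → ∀ u v → Dec (Reachable G u v)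
reachable? {n} G u v =
  map′ (via-sound G (allFin n)) (via-complete G) (via? G (allFin n) u v)

-- The graph without vertices has no components, so it is not connected.

Connected : Graph n → Set
Connected {n} G = NonZero n × (∀ u v → Reachable G u v)

connected? : (G : Graph n) → Dec (Connected G)
connected? {n} G = ℕ.nonZero? n ×-dec all? (λ u → all? (reachable? G u))

-- The increasing enumeration of a set of vertices.

element : (S : Subset n) → Fin ∣ S ∣ → Fin n
element (outside ∷ S) i       = suc (element S i)
element (inside  ∷ S) zero    = zero
element (inside  ∷ S) (suc i) = suc (element S i)

induced : Graph n → (S : Subset n) → Graph ∣ S ∣
induced G S = record
  { adj        = λ i j → adj G (element S i) (element S j)
  ; adj-sym    = λ i j → adj-sym G (element S i) (element S j)
  ; adj-irrefl = λ i → adj-irrefl G (element S i)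
  }

componentOf : Graph n → Fin n → Subset n
componentOf G v = tabulate (λ u → does (reachable? G v u))

componentSets : Graph n → List (Subset n)
componentSets {n} G =
  deduplicate (Vec.≡-dec _≟ᵇ_) (map (componentOf G) (allFin n))

components : Graph n → List (∃ Graph)
components G = map (λ S → ∣ S ∣ , induced G S) (componentSets G)

------------------------------------------------------------------------
-- Properties of graphs and functions on graphs

record GraphProperty (ℓ : Level) : Set (lsuc ℓ) where
  field
    holds     : Graph n → Set ℓ
    invariant : (G : Graph m) (H : Graph n) → G ≅ H → holds G → holds H

open GraphProperty public using (holds)

-- Both implications are needed: "connected" passes from a graph to its
-- components, yet it does not make the exponential formula true.  For the graph
-- without vertices the condition says that it has the property.

Homogeneous : GraphProperty ℓ → Set ℓ
Homogeneous P = ∀ {n} (G : Graph n) →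
  holds P G ⇔ All (λ C → holds P (proj₂ C)) (components G)

Satisfies : {I : Set ι} → (I → GraphProperty ℓ) → Graph n → Set (ι ⊔ ℓ)
Satisfies 𝒫 G = ∀ i → holds (𝒫 i) G

record AdditiveFunction : Set where
  field
    value     : Graph n → ℤ
    invariant : (G : Graph m) (H : Graph n) → G ≅ H → value G ≡ value H
    additive  : (G : Graph m) (H : Graph n) → value (G ⊕ H) ≡ value G ℤ.+ value H

open AdditiveFunction public using (value)

values : (Fin s → AdditiveFunction) → Graph n → Vec ℤ s
values f G = tabulate (λ i → value (f i) G)

HasValues : (Fin s → AdditiveFunction) → Vec ℤ s → Graph n → Set
HasValues f k G = ∀ i → value (f i) G ≡ lookup k i

hasValues? : (f : Fin s → AdditiveFunction) (k : Vec ℤ s) (G : Graph n) →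
             Dec (HasValues f k G)
hasValues? f k G = all? (λ i → value (f i) G ℤ.≟ lookup k i)

sumℚ : List ℚ → ℚ
sumℚ = foldr ℚ._+_ 0ℚ

-- ω n is the weight of a component of order n; ω 0 is never used.

h₀ : (ℕ → ℚ) → Graph n → ℚ
h₀ ω G = sumℚ (map (ω ∘ proj₁) (components G))

------------------------------------------------------------------------
-- Counting labeled graphs

subsets : ∀ n → List (Subset n)
subsets zero    = [ [] ]
subsets (suc n) = cartesianProductWith _∷_ (outside ∷ inside ∷ []) (subsets n)

-- Add a new vertex zero with the given set of neighbours.

extend : Subset n → Graph n → Graph (suc n)
extend {n} S G = record { adj = a ; adj-sym = a-sym ; adj-irrefl = a-irrefl }
  where
  a : Fin (suc n) → Fin (suc n) → Bool
  a zero    zero    = false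
  a zero    (suc v) = lookup S v
  a (suc u) zero    = lookup S u
  a (suc u) (suc v) = adj G u v

  a-sym : ∀ u v → a u v ≡ a v u
  a-sym zero    zero    = refl
  a-sym zero    (suc v) = refl
  a-sym (suc u) zero    = refl
  a-sym (suc u) (suc v) = adj-sym G u v

  a-irrefl : ∀ v → a v v ≡ false
  a-irrefl zero    = refl
  a-irrefl (suc v) = adj-irrefl G v

graphs : ∀ n → List (Graph n)
graphs zero    = [ record { adj = λ () ; adj-sym = λ () ; adj-irrefl = λ () } ]
graphs (suc n) = cartesianProductWith extend (subsets n) (graphs n)

-- graphs n contains every labeled graph on Fin n exactly once, up to _≈ᴳ_.

subsets-complete : (S : Subset n) → Any (S ≡_) (subsets n)
subsets-complete []      = here refl
subsets-complete (b ∷ S) =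
  Any.cartesianProductWith⁺ _∷_ (cong₂ _∷_) (bit b) (subsets-complete S)
  where
  bit : ∀ b → Any (b ≡_) (outside ∷ inside ∷ [])
  bit false = here refl
  bit true  = there (here refl)

subsets-unique : ∀ n → Unique.Unique (≡.setoid (Subset n)) (subsets n)
subsets-unique zero    = [] ∷ []
subsets-unique (suc n) =
  Unique.cartesianProductWith⁺ (≡.setoid _) (≡.setoid _) (≡.setoid _)
    _∷_ Vec.∷-injective (((λ ()) ∷ []) ∷ [] ∷ []) (subsets-unique n)

graphs-complete : (G : Graph n) → Any (G ≈ᴳ_) (graphs n)
graphs-complete {zero}  G = here (λ ())
graphs-complete {suc n} G =
  Any.cartesianProductWith⁺ extend glue (subsets-complete S) (graphs-complete G′)
  where
  S : Subset n
  S = tabulate (λ v → adj G zero (suc v))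

  G′ : Graph n
  G′ = record
    { adj        = λ u v → adj G (suc u) (suc v)
    ; adj-sym    = λ u v → adj-sym G (suc u) (suc v)
    ; adj-irrefl = λ v → adj-irrefl G (suc v)
    }

  glue : ∀ {S′ H} → S ≡ S′ → G′ ≈ᴳ H → G ≈ᴳ extend S′ H
  glue refl p zero    zero    = adj-irrefl G zero
  glue refl p zero    (suc v) = sym (Vec.lookup∘tabulate _ v)
  glue refl p (suc u) zero    = trans (adj-sym G (suc u) zero) (sym (Vec.lookup∘tabulate _ u))
  glue refl p (suc u) (suc v) = p u v

graphs-unique : ∀ n → Unique.Unique (graphSetoid n) (graphs n)
graphs-unique zero    = [] ∷ []
graphs-unique (suc n) =
  Unique.cartesianProductWith⁺ (≡.setoid _) (graphSetoid n) (graphSetoid (suc n))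
    extend split (subsets-unique n) (graphs-unique n)
  where
  lookup-injective : ∀ {n} {S S′ : Subset n} → (∀ i → lookup S i ≡ lookup S′ i) → S ≡ S′
  lookup-injective {S = []}    {[]}     p = refl
  lookup-injective {S = _ ∷ _} {_ ∷ _} p =
    cong₂ _∷_ (p zero) (lookup-injective (p ∘ suc))

  split : ∀ {S S′ G G′} → extend S G ≈ᴳ extend S′ G′ → S ≡ S′ × G ≈ᴳ G′
  split p = lookup-injective (λ v → p zero (suc v)) , λ u v → p (suc u) (suc v)

count : {Q : Pred (Graph n) ℓ} → Decidable Q → ℕ
count {n} Q? = length (filter Q? (graphs n))

------------------------------------------------------------------------
-- Monoid algebras over ℚ

-- Elements are represented by formal finite sums Σ q·m.  Two sums represent the
-- same element when they have the same coefficients.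

Sum : Set → Set
Sum M = List (ℚ × M)

scale : {M : Set} → ℚ → Sum M → Sum M
scale q = map (λ (r , m) → q ℚ.* r , m)

-- The linear extension of a map on monomials.

linear : {M N : Set} → (M → N) → Sum M → Sum N
linear φ = map (λ (q , m) → q , φ m)

coefficient : {M : Set} → DecidableEquality M → Sum M → M → ℚ
coefficient _≟_ p m = sumℚ (map proj₁ (filter (λ t → proj₂ t ≟ m) p))

-- Formal power series in x over the monoid algebra; a n is the coefficient of xⁿ.

Series : Set → Set
Series M = ℕ → Sum M

1/_! : ℕ → ℚ
1/ n ! = (+ 1 ℚ./ (n !)) {{n !≢0}}

module PowerSeries {M : Set} (_∙_ : Op₂ M) (e : M) where

  _*ˢ_ : Sum M → Sum M → Sum M
  _*ˢ_ = cartesianProductWith (λ (q , m) (r , m′) → q ℚ.* r , m ∙ m′)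

  one : Series M
  one zero    = [ 1ℚ , e ]
  one (suc _) = []

  _*_ : Series M → Series M → Series M
  (a * b) n = concat (map (λ i → a i *ˢ b (n ℕ.∸ i)) (upTo (suc n)))

  _^_ : Series M → ℕ → Series M
  a ^ zero  = one
  a ^ suc j = a * (a ^ j)

  -- Σⱼ aʲ / j! for a series a without constant term; then aʲ does not contribute
  -- to the coefficient of xⁿ when j > n.

  exp : Series M → Series M
  exp a n = concat (map (λ j → scale (1/ j !) ((a ^ j) n)) (upTo (suc n)))

------------------------------------------------------------------------
-- The generating function of connected graphs

-- A monomial in z₁, z₂, … is given by its exponents: the entry at position i
-- (counted from 0) is the exponent of zᵢ₊₁, and missing entries are 0.

ZMonomial : Set
ZMonomial = List ℕ

_·ᶻ_ : Op₂ ZMonomial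
[]      ·ᶻ β       = β
(a ∷ α) ·ᶻ []      = a ∷ α
(a ∷ α) ·ᶻ (b ∷ β) = a ℕ.+ b ∷ α ·ᶻ β

z : (n : ℕ) .{{_ : NonZero n}} → ZMonomial
z (suc i) = replicate i 0 ++ [ 1 ]

-- Monomials yᵏ·zᵅ.  The functions may take negative values, so the exponents of
-- the yᵢ are integers.

YZ : ℕ → Set
YZ s = Vec ℤ s × ZMonomial

_·ʸᶻ_ : Op₂ (YZ s)
(k , α) ·ʸᶻ (l , β) = zipWith ℤ._+_ k l , α ·ᶻ β

1ʸᶻ : YZ s
1ʸᶻ = Vec.replicate _ (+ 0) , []

exp : Series (YZ s) → Series (YZ s)
exp = PowerSeries.exp _·ʸᶻ_ 1ʸᶻ

module _ {I : Set ι} (𝒫 : I → GraphProperty ℓ)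
         (sat? : ∀ {n} (G : Graph n) → Dec (Satisfies 𝒫 G))
         (f : Fin s → AdditiveFunction) where

  g : (n : ℕ) → Vec ℤ s → ℕ
  g n k = count {n} (λ G → connected? G ×-dec (sat? G ×-dec hasValues? f k G))

  -- For fixed n, g n k vanishes unless k is the value vector of some graph on
  -- Fin n, so the sum over all k is a sum over these finitely many vectors.

  valueVectors : ℕ → List (Vec ℤ s)
  valueVectors n = deduplicate (Vec.≡-dec ℤ._≟_) (map (values f) (graphs n))

  g̃ : Series (YZ s)
  g̃ zero      = []
  g̃ n@(suc _) =
    map (λ k → (+ g n k ℚ./ 1) ℚ.* 1/ n ! , (k , z n)) (valueVectors n)

  numberOfGraphs : (ω : ℕ → ℚ) (n : ℕ) → Vec ℤ s → ℚ → ℕ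
  numberOfGraphs ω n k ν =
    count {n} (λ G → sat? G ×-dec (hasValues? f k G ×-dec (h₀ ω G ℚ.≟ ν)))

------------------------------------------------------------------------
-- The substitution zᵢ ↦ z^ωᵢ

-- Σᵢ ωᵢ αᵢ

weight : (ℕ → ℚ) → ZMonomial → ℚ
weight ω []      = 0ℚ
weight ω (a ∷ α) = ω 1 ℚ.* (+ a ℚ./ 1) ℚ.+ weight (ω ∘ suc) α

-- Monomials yᵏ·z^ν with a rational exponent ν.  The symbolic powers z^ν are
-- linearly independent over ℚ and multiply by adding exponents, so they span the
-- monoid algebra of (ℚ , +), which contains the image of the substitution.

YZ^ℚ : ℕ → Set
YZ^ℚ s = Vec ℤ s × ℚ

_≟ʸᶻ_ : DecidableEquality (YZ^ℚ s)
_≟ʸᶻ_ = Product.≡-dec (Vec.≡-dec ℤ._≟_) ℚ._≟_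

τ : (ℕ → ℚ) → Series (YZ s) → Series (YZ^ℚ s)
τ ω a n = linear (λ (k , α) → k , weight ω α) (a n)

{-# OPTIONS --safe #-}

-- Formal sums are compared through their linear functionals ∫ p φ = Σ q φ(m).
-- The exponential satisfies (exp a)′ = a′ exp a, so n! [xⁿ] exp g̃ obeys the
-- recurrence Tₙ₊₁ = Σ_{S ⊆ [n]} c(|S| + 1) T(n - |S|), where c counts connected
-- graphs.  Graphs on n + 1 vertices obey the same recurrence: S ∪ {0} is the
-- component of the vertex 0, and a graph in which S ∪ {0} has no edges to its
-- complement is a pair of independently chosen graphs on the two parts.  The
-- properties, the values of the fᵢ and h₀ split accordingly, because the components
-- of the graph are S ∪ {0} and the components of the rest.

module Submission where

open import Defs
open import Algebra.Core using (Op₂)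
open import Algebra.Properties.AbelianGroup using (identityˡ-unique)
open import Data.Bool.Base using (Bool; true; false; T; not; if_then_else_)
open import Data.Bool.Properties using (T?; T-≡; not-injective) renaming (_≟_ to _≟ᵇ_)
open import Data.Fin.Base using (Fin; zero; suc; splitAt; cast)
open import Data.Fin.Properties using (all?; +↔⊎; cast-trans; cast-is-id)
open import Data.Fin.Subset using (Subset; inside; outside; ∣_∣; ∁)
open import Data.Integer.Base as ℤ using (ℤ; +_)
import Data.Integer.Properties as ℤ
open import Data.List.Base using
  (List; []; _∷_; [_]; _++_; map; filter; length; concat; upTo; applyUpTo; allFin;
   cartesianProductWith; deduplicate)
open import Data.List.Membership.Propositional using (_∈_)
open import Data.List.Membership.Propositional.Properties using
  (∈-map⁺; ∈-map⁻; ∈-allFin; ∈-deduplicate⁺; ∈-deduplicate⁻)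
open import Data.List.Membership.Propositional.Properties.WithK using (unique∧set⇒bag)
import Data.List.Properties as List
open import Data.List.Relation.Binary.BagAndSetEquality using (∼bag⇒↭)
open import Data.List.Relation.Binary.Permutation.Propositional using (_↭_; ↭-sym; ↭⇒↭ₛ)
open import Data.List.Relation.Binary.Permutation.Propositional.Properties
  using (All-resp-↭) renaming (map⁺ to ↭-map⁺)
open import Data.List.Relation.Binary.Permutation.Setoid.Properties using (foldr-commMonoid)
open import Data.List.Relation.Unary.All as All using ([]; _∷_)
import Data.List.Relation.Unary.All.Properties as All
open import Data.List.Relation.Unary.AllPairs using (_∷_)
open import Data.List.Relation.Unary.Any using (here; there)
import Data.List.Relation.Unary.Unique.DecPropositional.Properties as UniqueDec
open import Data.List.Relation.Unary.Unique.Propositional using (Unique)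
import Data.List.Relation.Unary.Unique.Propositional.Properties as Unique
open import Data.Nat.Base as ℕ using (ℕ; zero; suc; NonZero; _!; s≤s⁻¹)
open import Data.Nat.Induction using (<-rec)
import Data.Nat.Properties as ℕ
open import Data.Product.Base using (∃; _×_; _,_; proj₁; proj₂; map₁)
open import Data.Rational.Base using (ℚ; 0ℚ; 1ℚ; _/_; _*_; _+_; toℚᵘ)
open import Data.Rational.Properties as ℚ using (*-zeroˡ; *-zeroʳ)
open import Data.Rational.Solver using (module +-*-Solver)
import Data.Rational.Unnormalised.Base as ℚᵘ
import Data.Rational.Unnormalised.Properties as ℚᵘ
open import Data.Sum.Base as Sum using (_⊎_; inj₁; inj₂)
open import Data.Sum.Properties using (inj₁-injective)
open import Data.Vec.Base as Vec using (Vec; lookup; tabulate)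
import Data.Vec.Properties as Vec
open import Function.Base using (_∘_; id)
open import Function.Bundles using (_⇔_; mk⇔; mk↔ₛ′; Inverse; Equivalence)
open import Function.Properties.Inverse using (↔-trans; ↔-sym; ↔-refl)
open import Level using (Level)
open import Relation.Binary.Construct.Closure.ReflexiveTransitive using (ε; _◅_; _◅◅_; gmap)
open import Relation.Binary.Definitions using (DecidableEquality)
open import Relation.Binary.PropositionalEquality using
  (_≡_; refl; sym; trans; cong; cong₂; subst; setoid; module ≡-Reasoning)
open import Relation.Nullary.Decidable using
  (Dec; does; yes; no; _×-dec_; _→-dec_; does-⇔; dec-true)
open import Relation.Nullary.Negation using (contradiction)
open import Relation.Unary using (Pred; Decidable)

open +-*-Solver using (_:=_; _:+_; _:*_; con) renaming (solve to ring)
open ≡-Reasoning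

private
  variable
    a b p ℓ : Level
    A : Set a
    B : Set b
    m n s : ℕ

-- Different lists can represent the same formal sum; since every statement about them is evaluated
-- under `∫`, no quotient has to be formed. These statements hold for all test functions at once,
-- because multiplication by a monomial m turns φ into `λ m′ → φ (m ∙ m′)`: the induction on n needs
-- its hypothesis for shifted tests, although only the indicator of one monomial is tested in the
-- end. The substitution of powers of z is moved into the test function, so that all it has to
-- satisfy is additivity of `weight`.
--
-- The factorials match for two reasons. A quantity depending only on the orders of S and its
-- complement sums to n! times a convolution weighted by 1/(i! j!). And 1/i! is (i + 1)/(i + 1)!, so
-- that distinguishing the component of the vertex 0 corresponds to differentiating g̃.
--
-- Labeled graphs are compared pointwise by `≈ᴳ`. The decoupling of the two sides of a separated
-- graph is therefore an identity between sums, proved by adding one vertex at a time, for weights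
-- that respect `≈ᴳ`.

+-congˡ : ∀ x {y z} → y ≡ z → x + y ≡ x + z
+-congˡ x refl = refl

-- Finite sums

∑ : List A → (A → ℚ) → ℚ
∑ xs f = sumℚ (map f xs)

∑-cong-∈ : (xs : List A) {f h : A → ℚ} → (∀ {x} → x ∈ xs → f x ≡ h x) → ∑ xs f ≡ ∑ xs h
∑-cong-∈ []       eq = refl
∑-cong-∈ (x ∷ xs) eq = cong₂ _+_ (eq (here refl)) (∑-cong-∈ xs (eq ∘ there))

∑-cong : (xs : List A) {f h : A → ℚ} → (∀ x → f x ≡ h x) → ∑ xs f ≡ ∑ xs h
∑-cong xs eq = ∑-cong-∈ xs (λ {x} _ → eq x)

∑-zero : (xs : List A) → ∑ xs (λ _ → 0ℚ) ≡ 0ℚ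
∑-zero []       = refl
∑-zero (x ∷ xs) = trans (ℚ.+-identityˡ _) (∑-zero xs)

∑-distrib-+ : (xs : List A) (f h : A → ℚ) → ∑ xs (λ x → f x + h x) ≡ ∑ xs f + ∑ xs h
∑-distrib-+ []       f h = refl
∑-distrib-+ (x ∷ xs) f h = trans (+-congˡ (f x + h x) (∑-distrib-+ xs f h))
  (ring 4 (λ a b c d → (a :+ b) :+ (c :+ d) := (a :+ c) :+ (b :+ d)) refl (f x) (h x) (∑ xs f) (∑ xs h))

*-distribˡ-∑ : ∀ c (xs : List A) (f : A → ℚ) → c * ∑ xs f ≡ ∑ xs (λ x → c * f x)
*-distribˡ-∑ c []       f = *-zeroʳ c
*-distribˡ-∑ c (x ∷ xs) f = trans (ℚ.*-distribˡ-+ c (f x) (∑ xs f)) (+-congˡ (c * f x) (*-distribˡ-∑ c xs f))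

∑-++ : (xs ys : List A) (f : A → ℚ) → ∑ (xs ++ ys) f ≡ ∑ xs f + ∑ ys f
∑-++ []       ys f = sym (ℚ.+-identityˡ _)
∑-++ (x ∷ xs) ys f = trans (+-congˡ (f x) (∑-++ xs ys f)) (sym (ℚ.+-assoc (f x) (∑ xs f) (∑ ys f)))

∑-map : (h : A → B) (xs : List A) (f : B → ℚ) → ∑ (map h xs) f ≡ ∑ xs (f ∘ h)
∑-map h xs f = cong sumℚ (sym (List.map-∘ xs))

∑-concat-map : (h : A → List B) (xs : List A) (f : B → ℚ) →
  ∑ (concat (map h xs)) f ≡ ∑ xs (λ x → ∑ (h x) f)
∑-concat-map h []       f = refl
∑-concat-map h (x ∷ xs) f = trans (∑-++ (h x) _ f) (+-congˡ (∑ (h x) f) (∑-concat-map h xs f))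

∑-cartesianProductWith : ∀ {c} {C : Set c} (h : A → B → C) xs ys (f : C → ℚ) →
  ∑ (cartesianProductWith h xs ys) f ≡ ∑ xs (λ x → ∑ ys (λ y → f (h x y)))
∑-cartesianProductWith h []       ys f = refl
∑-cartesianProductWith h (x ∷ xs) ys f = trans (∑-++ (map (h x) ys) _ f)
  (cong₂ _+_ (∑-map (h x) ys f) (∑-cartesianProductWith h xs ys f))

∑-swap : (xs : List A) (ys : List B) (f : A → B → ℚ) →
  ∑ xs (λ x → ∑ ys (f x)) ≡ ∑ ys (λ y → ∑ xs (λ x → f x y))
∑-swap []       ys f = sym (∑-zero ys)
∑-swap (x ∷ xs) ys f = trans (+-congˡ (∑ ys (f x)) (∑-swap xs ys f))
  (sym (∑-distrib-+ ys (f x) (λ y → ∑ xs (λ z → f z y))))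

-- Indicators

𝟙 : Dec A → ℚ
𝟙 d = if does d then 1ℚ else 0ℚ

𝟙-cong : A ⇔ B → (d : Dec A) (e : Dec B) → 𝟙 d ≡ 𝟙 e
𝟙-cong A⇔B d e = cong (if_then 1ℚ else 0ℚ) (does-⇔ A⇔B d e)

𝟙-yes : (d : Dec A) → A → 𝟙 d ≡ 1ℚ
𝟙-yes (yes _) x = refl
𝟙-yes (no ¬x) x = contradiction x ¬x

𝟙-× : (d : Dec A) (e : Dec B) → 𝟙 (d ×-dec e) ≡ 𝟙 d * 𝟙 e
𝟙-× (yes _) e = sym (ℚ.*-identityˡ (𝟙 e))
𝟙-× (no _)  e = sym (*-zeroˡ (𝟙 e))

-- Allows an identity that is valid only under A to be used inside a sum over all graphs: where A
-- fails, both products are 0.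
𝟙-guard : (d : Dec A) {x y : ℚ} → (A → x ≡ y) → 𝟙 d * x ≡ 𝟙 d * y
𝟙-guard (yes p) eq = cong (1ℚ *_) (eq p)
𝟙-guard (no _)  {x} {y} eq = trans (*-zeroˡ x) (sym (*-zeroˡ y))

∑-filter : {Q : Pred A p} (Q? : Decidable Q) (xs : List A) (f : A → ℚ) →
  ∑ (filter Q? xs) f ≡ ∑ xs (λ x → 𝟙 (Q? x) * f x)
∑-filter Q? []       f = refl
∑-filter Q? (x ∷ xs) f with Q? x
... | yes _ = cong₂ _+_ (sym (ℚ.*-identityˡ (f x))) (∑-filter Q? xs f)
... | no _  = trans (∑-filter Q? xs f)
  (sym (trans (cong₂ _+_ (*-zeroˡ (f x)) refl) (ℚ.+-identityˡ (∑ xs (λ z → 𝟙 (Q? z) * f z)))))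

-- Kronecker delta: uniqueness leaves exactly one nonvanishing indicator.
∑-select : (_≟_ : ∀ (x y : A) → Dec (x ≡ y)) {xs : List A} → Unique xs →
  ∀ {y} → y ∈ xs → (f : A → ℚ) → ∑ xs (λ x → 𝟙 (y ≟ x) * f x) ≡ f y
∑-select _≟_ {x ∷ xs} (x∉ ∷ u) (here refl) f = begin
  𝟙 (x ≟ x) * f x + ∑ xs (λ z → 𝟙 (x ≟ z) * f z)
    ≡⟨ cong₂ _+_ (cong (_* f x) (𝟙-yes (x ≟ x) refl)) (∑-cong-∈ xs vanish) ⟩
  1ℚ * f x + ∑ xs (λ _ → 0ℚ)
    ≡⟨ cong₂ _+_ (ℚ.*-identityˡ (f x)) (∑-zero xs) ⟩
  f x + 0ℚ
    ≡⟨ ℚ.+-identityʳ (f x) ⟩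
  f x ∎
  where
  vanish : ∀ {z} → z ∈ xs → 𝟙 (x ≟ z) * f z ≡ 0ℚ
  vanish {z} z∈ with x ≟ z
  ... | yes x≡z = contradiction x≡z (All.lookup x∉ z∈)
  ... | no _    = *-zeroˡ (f z)
∑-select _≟_ {x ∷ xs} (x∉ ∷ u) {y} (there y∈) f with y ≟ x
... | yes refl = contradiction refl (All.lookup x∉ y∈)
... | no _     = trans (cong₂ _+_ (*-zeroˡ (f x)) (∑-select _≟_ u y∈ f)) (ℚ.+-identityˡ (f y))

-- Natural numbers and factorials in ℚ

fromℕ : ℕ → ℚ
fromℕ n = + n / 1

-- `+ n / 1` is normalised through a gcd and does not reduce for a variable n, so the arithmetic of
-- `fromℕ` is derived from the unnormalised fractions.
toℚᵘ-fromℕ : ∀ n → toℚᵘ (fromℕ n) ℚᵘ.≃ ℚᵘ.mkℚᵘ (+ n) 0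
toℚᵘ-fromℕ n = ℚ.toℚᵘ-fromℚᵘ _

fromℕ-suc : ∀ n → fromℕ (suc n) ≡ 1ℚ + fromℕ n
fromℕ-suc n = ℚ.toℚᵘ-injective (ℚᵘ.≃-trans (toℚᵘ-fromℕ (suc n)) (ℚᵘ.≃-sym
  (ℚᵘ.≃-trans (ℚ.toℚᵘ-homo-+ 1ℚ (fromℕ n))
  (ℚᵘ.≃-trans (ℚᵘ.+-congʳ ℚᵘ.1ℚᵘ (toℚᵘ-fromℕ n))
  (ℚᵘ.*≡* (cong (ℤ._* + 1) (cong₂ ℤ._+_ {x = + 1} refl (ℤ.*-identityʳ (+ n)))))))))

fromℕ-+ : ∀ m n → fromℕ (m ℕ.+ n) ≡ fromℕ m + fromℕ n
fromℕ-+ zero    n = sym (ℚ.+-identityˡ _)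
fromℕ-+ (suc m) n = begin
  fromℕ (suc (m ℕ.+ n))      ≡⟨ fromℕ-suc (m ℕ.+ n) ⟩
  1ℚ + fromℕ (m ℕ.+ n)       ≡⟨ +-congˡ 1ℚ (fromℕ-+ m n) ⟩
  1ℚ + (fromℕ m + fromℕ n)   ≡⟨ ℚ.+-assoc 1ℚ (fromℕ m) (fromℕ n) ⟨
  1ℚ + fromℕ m + fromℕ n     ≡⟨ cong (_+ fromℕ n) (fromℕ-suc m) ⟨
  fromℕ (suc m) + fromℕ n    ∎

fromℕ-* : ∀ m n → fromℕ (m ℕ.* n) ≡ fromℕ m * fromℕ n
fromℕ-* zero    n = sym (*-zeroˡ (fromℕ n))
fromℕ-* (suc m) n = begin
  fromℕ (n ℕ.+ m ℕ.* n)         ≡⟨ fromℕ-+ n _ ⟩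
  fromℕ n + fromℕ (m ℕ.* n)     ≡⟨ +-congˡ (fromℕ n) (fromℕ-* m n) ⟩
  fromℕ n + fromℕ m * fromℕ n   ≡⟨ ring 2 (λ x y → y :+ x :* y := (con 1ℚ :+ x) :* y) refl (fromℕ m) (fromℕ n) ⟩
  (1ℚ + fromℕ m) * fromℕ n      ≡⟨ cong (_* fromℕ n) (fromℕ-suc m) ⟨
  fromℕ (suc m) * fromℕ n       ∎

fromℕ-inverse : ∀ d .{{_ : NonZero d}} → fromℕ d * (+ 1 / d) ≡ 1ℚ
fromℕ-inverse d@(suc d-1) = ℚ.toℚᵘ-injective
  (ℚᵘ.≃-trans (ℚ.toℚᵘ-homo-* (fromℕ d) (+ 1 / d))
  (ℚᵘ.≃-trans (ℚᵘ.*-cong (toℚᵘ-fromℕ d) (ℚ.toℚᵘ-fromℚᵘ (ℚᵘ.mkℚᵘ (+ 1) d-1)))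
  (ℚᵘ.*≡* (trans (ℤ.*-identityʳ (+ d ℤ.* + 1)) (trans (ℤ.*-identityʳ (+ d))
    (sym (trans (ℤ.*-identityˡ (+ (1 ℕ.* d))) (cong (λ m → + m) (ℕ.*-identityˡ d)))))))))

!*1/! : ∀ n → fromℕ (n !) * 1/ n ! ≡ 1ℚ
!*1/! n = fromℕ-inverse (n !) {{n ℕ.!≢0}}

1/!-suc : ∀ n → fromℕ (suc n) * 1/ suc n ! ≡ 1/ n !
1/!-suc n = begin
  r * v                 ≡⟨ ℚ.*-identityʳ (r * v) ⟨
  r * v * 1ℚ            ≡⟨ cong (r * v *_) (!*1/! n) ⟨
  r * v * (t * u)       ≡⟨ ring 4 (λ r v t u → r :* v :* (t :* u) := r :* t :* v :* u) refl r v t u ⟩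
  r * t * v * u         ≡⟨ cong (λ x → x * v * u) (fromℕ-* (suc n) (n !)) ⟨
  fromℕ (suc n !) * v * u ≡⟨ cong (_* u) (!*1/! (suc n)) ⟩
  1ℚ * u                ≡⟨ ℚ.*-identityˡ u ⟩
  u                     ∎
  where
  r = fromℕ (suc n)
  t = fromℕ (n !)
  u = 1/ n !
  v = 1/ suc n !

length-∑ : (xs : List A) → fromℕ (length xs) ≡ ∑ xs (λ _ → 1ℚ)
length-∑ []       = refl
length-∑ (x ∷ xs) = trans (fromℕ-suc (length xs)) (+-congˡ 1ℚ (length-∑ xs))

fromℕ-count : ∀ {n} {Q : Pred (Graph n) p} (Q? : Decidable Q) →
  fromℕ (count Q?) ≡ ∑ (graphs n) (λ G → 𝟙 (Q? G))
fromℕ-count {n = n} Q? = begin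
  fromℕ (count Q?)                        ≡⟨ length-∑ (filter Q? (graphs n)) ⟩
  ∑ (filter Q? (graphs n)) (λ _ → 1ℚ)     ≡⟨ ∑-filter Q? (graphs n) _ ⟩
  ∑ (graphs n) (λ G → 𝟙 (Q? G) * 1ℚ)      ≡⟨ ∑-cong (graphs n) (λ G → ℚ.*-identityʳ _) ⟩
  ∑ (graphs n) (λ G → 𝟙 (Q? G))           ∎

-- Sums over the pairs (i , j) with i + j = n

antidiagonal : ℕ → List (ℕ × ℕ)
antidiagonal zero    = [ 0 , 0 ]
antidiagonal (suc n) = (0 , suc n) ∷ map (map₁ suc) (antidiagonal n)

∑ᵈ : ℕ → (ℕ → ℕ → ℚ) → ℚ
∑ᵈ n f = ∑ (antidiagonal n) (λ (i , j) → f i j)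

∑ᵈ-cons : ∀ n f → ∑ᵈ (suc n) f ≡ f 0 (suc n) + ∑ᵈ n (λ i j → f (suc i) j)
∑ᵈ-cons n f = +-congˡ (f 0 (suc n)) (∑-map (map₁ suc) (antidiagonal n) (λ (i , j) → f i j))

∑ᵈ-snoc : ∀ n f → ∑ᵈ (suc n) f ≡ ∑ᵈ n (λ i j → f i (suc j)) + f (suc n) 0
∑ᵈ-snoc zero    f = ring 2 (λ x y → x :+ (y :+ con 0ℚ) := x :+ con 0ℚ :+ y) refl (f 0 1) (f 1 0)
∑ᵈ-snoc (suc n) f = begin
  ∑ᵈ (suc (suc n)) f
    ≡⟨ ∑ᵈ-cons (suc n) f ⟩
  f 0 (2 ℕ.+ n) + ∑ᵈ (suc n) (λ i j → f (suc i) j)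
    ≡⟨ +-congˡ (f 0 (2 ℕ.+ n)) (∑ᵈ-snoc n (λ i j → f (suc i) j)) ⟩
  f 0 (2 ℕ.+ n) + (∑ᵈ n (λ i j → f (suc i) (suc j)) + f (2 ℕ.+ n) 0)
    ≡⟨ ℚ.+-assoc (f 0 (2 ℕ.+ n)) (∑ᵈ n (λ i j → f (suc i) (suc j))) (f (2 ℕ.+ n) 0) ⟨
  f 0 (2 ℕ.+ n) + ∑ᵈ n (λ i j → f (suc i) (suc j)) + f (2 ℕ.+ n) 0
    ≡⟨ cong (_+ f (2 ℕ.+ n) 0) (∑ᵈ-cons n (λ i j → f i (suc j))) ⟨
  ∑ᵈ (suc n) (λ i j → f i (suc j)) + f (2 ℕ.+ n) 0 ∎

∈-antidiagonal : ∀ n {i j} → (i , j) ∈ antidiagonal n → i ℕ.+ j ≡ n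
∈-antidiagonal zero    (here refl) = refl
∈-antidiagonal (suc n) (here refl) = refl
∈-antidiagonal (suc n) (there ij∈) with ∈-map⁻ (map₁ suc) ij∈
... | _ , ij∈′ , refl = cong suc (∈-antidiagonal n ij∈′)

∑ᵈ-cong-+ : ∀ n {f h : ℕ → ℕ → ℚ} → (∀ i j → i ℕ.+ j ≡ n → f i j ≡ h i j) → ∑ᵈ n f ≡ ∑ᵈ n h
∑ᵈ-cong-+ n eq = ∑-cong-∈ (antidiagonal n) (λ {(i , j)} ij∈ → eq i j (∈-antidiagonal n ij∈))

∑ᵈ-cong : ∀ n {f h : ℕ → ℕ → ℚ} → (∀ i j → f i j ≡ h i j) → ∑ᵈ n f ≡ ∑ᵈ n h
∑ᵈ-cong n eq = ∑ᵈ-cong-+ n (λ i j _ → eq i j)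

-- Removes the truncated subtraction from the Cauchy product; on pairs, either entry can be peeled
-- off by recursion.
∑-upTo : ∀ n (f : ℕ → ℕ → ℚ) → ∑ (upTo (suc n)) (λ i → f i (n ℕ.∸ i)) ≡ ∑ᵈ n f
∑-upTo zero    f = refl
∑-upTo (suc n) f = begin
  f 0 (suc n) + ∑ (applyUpTo suc (suc n)) (λ i → f i (suc n ℕ.∸ i))
    ≡⟨ cong (λ xs → f 0 (suc n) + ∑ xs (λ i → f i (suc n ℕ.∸ i))) (List.map-upTo suc (suc n)) ⟨
  f 0 (suc n) + ∑ (map suc (upTo (suc n))) (λ i → f i (suc n ℕ.∸ i))
    ≡⟨ +-congˡ (f 0 (suc n)) (∑-map suc (upTo (suc n)) (λ i → f i (suc n ℕ.∸ i))) ⟩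
  f 0 (suc n) + ∑ (upTo (suc n)) (λ i → f (suc i) (n ℕ.∸ i))
    ≡⟨ +-congˡ (f 0 (suc n)) (∑-upTo n (λ i → f (suc i))) ⟩
  f 0 (suc n) + ∑ᵈ n (λ i j → f (suc i) j)
    ≡⟨ ∑ᵈ-cons n f ⟨
  ∑ᵈ (suc n) f ∎

∑ᵈ³ : ℕ → (ℕ → ℕ → ℕ → ℚ) → ℚ
∑ᵈ³ n f = ∑ᵈ n (λ i j → ∑ᵈ j (f i))

∑ᵈ³-cons : ∀ n f → ∑ᵈ³ (suc n) f ≡ ∑ᵈ (suc n) (f 0) + ∑ᵈ³ n (λ i → f (suc i))
∑ᵈ³-cons n f = ∑ᵈ-cons n (λ i j → ∑ᵈ j (f i))

-- The counterpart of `∑ᵈ³-cons` that splits off the triples with second entry zero. The two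
-- together make `∑ᵈ³-swap` an induction on n.
∑ᵈ³-cons₂ : ∀ n f →
  ∑ᵈ³ (suc n) f ≡ ∑ᵈ (suc n) (λ i → f i 0) + ∑ᵈ³ n (λ i k → f i (suc k))
∑ᵈ³-cons₂ n f = begin
  ∑ᵈ³ (suc n) f
    ≡⟨ ∑ᵈ-snoc n (λ i j → ∑ᵈ j (f i)) ⟩
  ∑ᵈ n (λ i j → ∑ᵈ (suc j) (f i)) + (f (suc n) 0 0 + 0ℚ)
    ≡⟨ cong (_+ (f (suc n) 0 0 + 0ℚ)) (∑ᵈ-cong n (λ i j → ∑ᵈ-cons j (f i))) ⟩
  ∑ᵈ n (λ i j → f i 0 (suc j) + ∑ᵈ j (λ k → f i (suc k))) + (f (suc n) 0 0 + 0ℚ)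
    ≡⟨ cong (_+ (f (suc n) 0 0 + 0ℚ)) (∑-distrib-+ (antidiagonal n) (λ (i , j) → f i 0 (suc j)) (λ (i , j) → ∑ᵈ j (λ k → f i (suc k)))) ⟩
  ∑ᵈ n (λ i j → f i 0 (suc j)) + ∑ᵈ³ n (λ i k → f i (suc k)) + (f (suc n) 0 0 + 0ℚ)
    ≡⟨ ring 3 (λ x y z → x :+ y :+ (z :+ con 0ℚ) := x :+ z :+ y) refl X (∑ᵈ³ n (λ i k → f i (suc k))) (f (suc n) 0 0) ⟩
  ∑ᵈ n (λ i j → f i 0 (suc j)) + f (suc n) 0 0 + ∑ᵈ³ n (λ i k → f i (suc k))
    ≡⟨ cong (_+ ∑ᵈ³ n (λ i k → f i (suc k))) (∑ᵈ-snoc n (λ i → f i 0)) ⟨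
  ∑ᵈ (suc n) (λ i → f i 0) + ∑ᵈ³ n (λ i k → f i (suc k)) ∎
  where X = ∑ᵈ n (λ i j → f i 0 (suc j))

∑ᵈ³-swap : ∀ n f → ∑ᵈ³ n f ≡ ∑ᵈ³ n (λ i k → f k i)
∑ᵈ³-swap zero    f = refl
∑ᵈ³-swap (suc n) f = begin
  ∑ᵈ³ (suc n) f
    ≡⟨ ∑ᵈ³-cons n f ⟩
  ∑ᵈ (suc n) (f 0) + ∑ᵈ³ n (λ i → f (suc i))
    ≡⟨ +-congˡ (∑ᵈ (suc n) (f 0)) (∑ᵈ³-swap n (λ i → f (suc i))) ⟩
  ∑ᵈ (suc n) (f 0) + ∑ᵈ³ n (λ i k → f (suc k) i)
    ≡⟨ ∑ᵈ³-cons₂ n (λ i k → f k i) ⟨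
  ∑ᵈ³ (suc n) (λ i k → f k i) ∎

-- Since n + 1 = i + j on the antidiagonal, this is the Leibniz rule.
∑ᵈ-suc-* : ∀ n f → fromℕ (suc n) * ∑ᵈ (suc n) f ≡
  ∑ᵈ n (λ i j → fromℕ (suc i) * f (suc i) j) + ∑ᵈ n (λ i j → fromℕ (suc j) * f i (suc j))
∑ᵈ-suc-* n f = begin
  fromℕ (suc n) * ∑ᵈ (suc n) f
    ≡⟨ *-distribˡ-∑ (fromℕ (suc n)) (antidiagonal (suc n)) (λ (i , j) → f i j) ⟩
  ∑ᵈ (suc n) (λ i j → fromℕ (suc n) * f i j)
    ≡⟨ ∑ᵈ-cong-+ (suc n) split ⟩
  ∑ᵈ (suc n) (λ i j → fromℕ i * f i j + fromℕ j * f i j)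
    ≡⟨ ∑-distrib-+ (antidiagonal (suc n)) (λ (i , j) → fromℕ i * f i j) (λ (i , j) → fromℕ j * f i j) ⟩
  ∑ᵈ (suc n) (λ i j → fromℕ i * f i j) + ∑ᵈ (suc n) (λ i j → fromℕ j * f i j)
    ≡⟨ cong₂ _+_
         (trans (∑ᵈ-cons n (λ i j → fromℕ i * f i j)) (trans (cong (_+ X) (*-zeroˡ (f 0 (suc n)))) (ℚ.+-identityˡ X)))
         (trans (∑ᵈ-snoc n (λ i j → fromℕ j * f i j)) (trans (+-congˡ Y (*-zeroˡ (f (suc n) 0))) (ℚ.+-identityʳ Y))) ⟩
  X + Y ∎
  where
  X = ∑ᵈ n (λ i j → fromℕ (suc i) * f (suc i) j)
  Y = ∑ᵈ n (λ i j → fromℕ (suc j) * f i (suc j))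
  split : ∀ i j → i ℕ.+ j ≡ suc n → fromℕ (suc n) * f i j ≡ fromℕ i * f i j + fromℕ j * f i j
  split i j eq = trans (cong (λ m → fromℕ m * f i j) (sym eq))
    (trans (cong (_* f i j) (fromℕ-+ i j)) (ℚ.*-distribʳ-+ (f i j) (fromℕ i) (fromℕ j)))

-- There are n!/(i! j!) sets S of order i with complement of order j. In the induction, Pascal's
-- rule (is the first element in S or not?) takes the form of the Leibniz rule `∑ᵈ-suc-*`.
∑-subsets : ∀ n (h : ℕ → ℕ → ℚ) →
  ∑ (subsets n) (λ S → h ∣ S ∣ ∣ ∁ S ∣) ≡ fromℕ (n !) * ∑ᵈ n (λ i j → 1/ i ! * 1/ j ! * h i j)
∑-subsets zero    h = ring 1 (λ x → x :+ con 0ℚ := con 1ℚ :* (con 1ℚ :* con 1ℚ :* x :+ con 0ℚ)) refl (h 0 0)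
∑-subsets (suc n) h = begin
  ∑ (subsets (suc n)) (λ S → h ∣ S ∣ ∣ ∁ S ∣)
    ≡⟨ ∑-cartesianProductWith Vec._∷_ (outside ∷ inside ∷ []) (subsets n) _ ⟩
  ∑ (subsets n) (λ S → h ∣ S ∣ (suc ∣ ∁ S ∣)) + (∑ (subsets n) (λ S → h (suc ∣ S ∣) ∣ ∁ S ∣) + 0ℚ)
    ≡⟨ cong₂ (λ x y → x + (y + 0ℚ)) (∑-subsets n (λ i j → h i (suc j))) (∑-subsets n (λ i j → h (suc i) j)) ⟩
  fromℕ (n !) * X + (fromℕ (n !) * Y + 0ℚ)
    ≡⟨ ring 3 (λ c x y → c :* x :+ (c :* y :+ con 0ℚ) := c :* (y :+ x)) refl (fromℕ (n !)) X Y ⟩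
  fromℕ (n !) * (Y + X)
    ≡⟨ cong (fromℕ (n !) *_) (cong₂ _+_ (∑ᵈ-cong n left) (∑ᵈ-cong n right)) ⟩
  fromℕ (n !) * (∑ᵈ n (λ i j → fromℕ (suc i) * w (suc i) j) + ∑ᵈ n (λ i j → fromℕ (suc j) * w i (suc j)))
    ≡⟨ cong (fromℕ (n !) *_) (∑ᵈ-suc-* n w) ⟨
  fromℕ (n !) * (fromℕ (suc n) * ∑ᵈ (suc n) w)
    ≡⟨ ring 3 (λ c d x → c :* (d :* x) := d :* c :* x) refl (fromℕ (n !)) (fromℕ (suc n)) (∑ᵈ (suc n) w) ⟩
  fromℕ (suc n) * fromℕ (n !) * ∑ᵈ (suc n) w
    ≡⟨ cong (_* ∑ᵈ (suc n) w) (fromℕ-* (suc n) (n !)) ⟨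
  fromℕ (suc n !) * ∑ᵈ (suc n) w ∎
  where
  w : ℕ → ℕ → ℚ
  w i j = 1/ i ! * 1/ j ! * h i j
  X = ∑ᵈ n (λ i j → 1/ i ! * 1/ j ! * h i (suc j))
  Y = ∑ᵈ n (λ i j → 1/ i ! * 1/ j ! * h (suc i) j)
  left : ∀ i j → 1/ i ! * 1/ j ! * h (suc i) j ≡ fromℕ (suc i) * w (suc i) j
  left i j = trans (cong (λ u → u * 1/ j ! * h (suc i) j) (sym (1/!-suc i)))
    (ring 4 (λ s u v x → s :* u :* v :* x := s :* (u :* v :* x)) refl (fromℕ (suc i)) (1/ suc i !) (1/ j !) (h (suc i) j))
  right : ∀ i j → 1/ i ! * 1/ j ! * h i (suc j) ≡ fromℕ (suc j) * w i (suc j)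
  right i j = trans (cong (λ v → 1/ i ! * v * h i (suc j)) (sym (1/!-suc j)))
    (ring 4 (λ s u v x → u :* (s :* v) :* x := s :* (u :* v :* x)) refl (fromℕ (suc j)) (1/ i !) (1/ suc j !) (h i (suc j)))

-- The formal exponential

∫ : {M : Set} → Sum M → (M → ℚ) → ℚ
∫ p φ = ∑ p (λ (q , m) → q * φ m)

module _ {M : Set} where

  ∫-cong : (p : Sum M) {φ ψ : M → ℚ} → (∀ m → φ m ≡ ψ m) → ∫ p φ ≡ ∫ p ψ
  ∫-cong p eq = ∑-cong p (λ (q , m) → cong (q *_) (eq m))

  ∫-∑ : (p : Sum M) (xs : List A) (φ : M → A → ℚ) →
    ∫ p (λ m → ∑ xs (φ m)) ≡ ∑ xs (λ x → ∫ p (λ m → φ m x))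
  ∫-∑ p xs φ = trans (∑-cong p (λ (q , m) → *-distribˡ-∑ q xs (φ m)))
    (∑-swap p xs (λ (q , m) x → q * φ m x))

  ∫-* : ∀ c (p : Sum M) (φ : M → ℚ) → ∫ p (λ m → c * φ m) ≡ c * ∫ p φ
  ∫-* c p φ = trans
    (∑-cong p (λ (q , m) → ring 3 (λ q c x → q :* (c :* x) := c :* (q :* x)) refl q c (φ m)))
    (sym (*-distribˡ-∑ c p (λ (q , m) → q * φ m)))

  ∫-zero : (p : Sum M) → ∫ p (λ _ → 0ℚ) ≡ 0ℚ
  ∫-zero p = trans (∑-cong p (λ (q , m) → *-zeroʳ q)) (∑-zero p)

  ∫-swap : ∀ {N : Set} (p : Sum M) (r : Sum N) (φ : M → N → ℚ) →
    ∫ p (λ m → ∫ r (φ m)) ≡ ∫ r (λ n → ∫ p (λ m → φ m n))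
  ∫-swap p r φ = trans (∫-∑ p r (λ m (q , n) → q * φ m n))
    (∑-cong r (λ (q , n) → ∫-* q p (λ m → φ m n)))

  ∫-scale : ∀ c (p : Sum M) (φ : M → ℚ) → ∫ (scale c p) φ ≡ c * ∫ p φ
  ∫-scale c p φ = trans (∑-map (λ (q , m) → c * q , m) p (λ (q , m) → q * φ m))
    (trans (∑-cong p (λ (q , m) → ℚ.*-assoc c q (φ m)))
    (sym (*-distribˡ-∑ c p (λ (q , m) → q * φ m))))

  ∫-linear : ∀ {N : Set} (t : M → N) (p : Sum M) (φ : N → ℚ) → ∫ (linear t p) φ ≡ ∫ p (φ ∘ t)
  ∫-linear t p φ = ∑-map (λ (q , m) → q , t m) p (λ (q , n) → q * φ n)

  coefficient-∫ : (_≟_ : DecidableEquality M) (p : Sum M) (m : M) →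
    coefficient _≟_ p m ≡ ∫ p (λ m′ → 𝟙 (m′ ≟ m))
  coefficient-∫ _≟_ p m = trans (∑-filter (λ t → proj₂ t ≟ m) p proj₁)
    (∑-cong p (λ (q , m′) → ℚ.*-comm (𝟙 (m′ ≟ m)) q))

module Exponential {M : Set} (_∙_ : Op₂ M) (e : M)
  (∙-leftComm : ∀ x y z → (x ∙ (y ∙ z)) ≡ (y ∙ (x ∙ z))) where

  open PowerSeries _∙_ e renaming (_*_ to _⊛_; exp to expˢ)

  ∫-*ˢ : ∀ p r φ → ∫ (p *ˢ r) φ ≡ ∫ p (λ m → ∫ r (λ m′ → φ (m ∙ m′)))
  ∫-*ˢ p r φ = trans
    (∑-cartesianProductWith (λ (q , m) (r , m′) → q * r , m ∙ m′) p r (λ (q , m) → q * φ m))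
    (∑-cong p (λ (q , m) → trans
      (∑-cong r (λ (q′ , m′) → ℚ.*-assoc q q′ (φ (m ∙ m′))))
      (sym (*-distribˡ-∑ q r (λ (q′ , m′) → q′ * φ (m ∙ m′))))))

  ∫-⊛ : ∀ (a b : Series M) n φ →
    ∫ ((a ⊛ b) n) φ ≡ ∑ᵈ n (λ i j → ∫ (a i) (λ m → ∫ (b j) (λ m′ → φ (m ∙ m′))))
  ∫-⊛ a b n φ = begin
    ∫ ((a ⊛ b) n) φ
      ≡⟨ ∑-concat-map (λ i → a i *ˢ b (n ℕ.∸ i)) (upTo (suc n)) (λ (q , m) → q * φ m) ⟩
    ∑ (upTo (suc n)) (λ i → ∫ (a i *ˢ b (n ℕ.∸ i)) φ)
      ≡⟨ ∑-upTo n (λ i j → ∫ (a i *ˢ b j) φ) ⟩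
    ∑ᵈ n (λ i j → ∫ (a i *ˢ b j) φ)
      ≡⟨ ∑ᵈ-cong n (λ i j → ∫-*ˢ (a i) (b j) φ) ⟩
    ∑ᵈ n (λ i j → ∫ (a i) (λ m → ∫ (b j) (λ m′ → φ (m ∙ m′)))) ∎

  module _ (a : Series M) (a₀≡0 : a 0 ≡ []) where

    ∫a₀ : ∀ φ → ∫ (a 0) φ ≡ 0ℚ
    ∫a₀ φ = cong (λ p → ∫ p φ) a₀≡0

    -- Without a constant term, each factor contributes degree at least 1.
    ^-vanishes : ∀ j {n} φ → n ℕ.< j → ∫ ((a ^ j) n) φ ≡ 0ℚ
    ^-vanishes (suc j) {n} φ n<1+j = begin
      ∫ ((a ⊛ (a ^ j)) n) φ
        ≡⟨ ∫-⊛ a (a ^ j) n φ ⟩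
      ∑ᵈ n (λ i k → ∫ (a i) (λ m → ∫ ((a ^ j) k) (λ m′ → φ (m ∙ m′))))
        ≡⟨ ∑ᵈ-cong-+ n vanish ⟩
      ∑ᵈ n (λ _ _ → 0ℚ)
        ≡⟨ ∑-zero (antidiagonal n) ⟩
      0ℚ ∎
      where
      vanish : ∀ i k → i ℕ.+ k ≡ n → ∫ (a i) (λ m → ∫ ((a ^ j) k) (λ m′ → φ (m ∙ m′))) ≡ 0ℚ
      vanish zero    k eq = ∫a₀ _
      vanish (suc i) k eq = trans
        (∫-cong (a (suc i)) (λ m → ^-vanishes j (λ m′ → φ (m ∙ m′)) k<j)) (∫-zero (a (suc i)))
        where
        k<j : k ℕ.< j
        k<j = ℕ.<-≤-trans (subst (k ℕ.<_) eq (ℕ.s≤s (ℕ.m≤n+m k i))) (s≤s⁻¹ n<1+j)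

    -- The coefficient of xⁿ in a′ b, where a′ is the derivative of a.
    ∫a′_at_of_ : Series M → ℕ → (M → ℚ) → ℚ
    ∫a′ b at n of φ = ∑ᵈ n (λ i k →
      fromℕ (suc i) * ∫ (a (suc i)) (λ m → ∫ (b k) (λ m′ → φ (m ∙ m′))))

    -- (aʲ⁺¹)′ = (j + 1) a′ aʲ
    ^-derivative : ∀ j n φ →
      fromℕ (suc n) * ∫ ((a ^ suc j) (suc n)) φ ≡ fromℕ (suc j) * (∫a′ (a ^ j) at n of φ)
    ^-derivative j n φ = begin
      fromℕ (suc n) * ∫ ((a ⊛ (a ^ j)) (suc n)) φ
        ≡⟨ cong (fromℕ (suc n) *_) (∫-⊛ a (a ^ j) (suc n) φ) ⟩
      fromℕ (suc n) * ∑ᵈ (suc n) f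
        ≡⟨ ∑ᵈ-suc-* n f ⟩
      D + ∑ᵈ n (λ i k → fromℕ (suc k) * f i (suc k))
        ≡⟨ +-congˡ D (rest j) ⟩
      D + fromℕ j * D
        ≡⟨ ring 2 (λ x y → x :+ y :* x := (con 1ℚ :+ y) :* x) refl D (fromℕ j) ⟩
      (1ℚ + fromℕ j) * D
        ≡⟨ cong (_* D) (fromℕ-suc j) ⟨
      fromℕ (suc j) * D ∎
      where
      f : ℕ → ℕ → ℚ
      f i k = ∫ (a i) (λ m → ∫ ((a ^ j) k) (λ m′ → φ (m ∙ m′)))
      D = ∫a′ (a ^ j) at n of φ
      -- The second Leibniz term: a (aʲ)′ = j a′ aʲ. For j = 0 the power is constant and has empty
      -- coefficients in positive degree; otherwise the derivative of the lower power is known by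
      -- induction, and its factor a′ has to be moved past a.
      rest : ∀ j → ∑ᵈ n (λ i k → fromℕ (suc k) * ∫ (a i) (λ m → ∫ ((a ^ j) (suc k)) (λ m′ → φ (m ∙ m′))))
        ≡ fromℕ j * (∫a′ (a ^ j) at n of φ)
      rest zero    = begin
        ∑ᵈ n (λ i k → fromℕ (suc k) * ∫ (a i) (λ m → 0ℚ))
          ≡⟨ ∑ᵈ-cong n (λ i k → trans (cong (fromℕ (suc k) *_) (∫-zero (a i))) (*-zeroʳ (fromℕ (suc k)))) ⟩
        ∑ᵈ n (λ i k → 0ℚ)
          ≡⟨ ∑-zero (antidiagonal n) ⟩
        0ℚ
          ≡⟨ *-zeroˡ (∫a′ one at n of φ) ⟨
        0ℚ * (∫a′ one at n of φ) ∎
      rest (suc j) = begin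
        ∑ᵈ n (λ i k → fromℕ (suc k) * ∫ (a i) (λ m → ∫ ((a ^ suc j) (suc k)) (λ m′ → φ (m ∙ m′))))
          ≡⟨ ∑ᵈ-cong n step ⟩
        ∑ᵈ n (λ i k → c * ∑ᵈ k (F i))
          ≡⟨ *-distribˡ-∑ c (antidiagonal n) (λ (i , k) → ∑ᵈ k (F i)) ⟨
        c * ∑ᵈ³ n F
          ≡⟨ cong (c *_) (∑ᵈ³-swap n F) ⟩
        c * ∑ᵈ³ n (λ l i → F i l)
          ≡⟨ cong (c *_) (∑ᵈ-cong n collect) ⟩
        c * (∫a′ (a ^ suc j) at n of φ) ∎
        where
        c = fromℕ (suc j)
        F : ℕ → ℕ → ℕ → ℚ
        F i l k = fromℕ (suc l) * ∫ (a (suc l)) (λ m′ → ∫ (a i) (λ m →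
          ∫ ((a ^ j) k) (λ m″ → φ (m′ ∙ (m ∙ m″)))))
        -- Brings the differentiated factor to the front; this is where `∙-leftComm` enters.
        exchange : ∀ i l k → ∫ (a i) (λ m → fromℕ (suc l) * ∫ (a (suc l)) (λ m′ →
          ∫ ((a ^ j) k) (λ m″ → φ (m ∙ (m′ ∙ m″))))) ≡ F i l k
        exchange i l k = trans (∫-* (fromℕ (suc l)) (a i) _) (cong (fromℕ (suc l) *_)
          (trans (∫-swap (a i) (a (suc l)) _)
          (∫-cong (a (suc l)) (λ m′ → ∫-cong (a i) (λ m →
            ∫-cong ((a ^ j) k) (λ m″ → cong φ (∙-leftComm m m′ m″)))))))
        step : ∀ i k → fromℕ (suc k) * ∫ (a i) (λ m → ∫ ((a ^ suc j) (suc k)) (λ m′ → φ (m ∙ m′)))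
          ≡ c * ∑ᵈ k (F i)
        step i k = begin
          fromℕ (suc k) * ∫ (a i) (λ m → ∫ ((a ^ suc j) (suc k)) (λ m′ → φ (m ∙ m′)))
            ≡⟨ ∫-* (fromℕ (suc k)) (a i) _ ⟨
          ∫ (a i) (λ m → fromℕ (suc k) * ∫ ((a ^ suc j) (suc k)) (λ m′ → φ (m ∙ m′)))
            ≡⟨ ∫-cong (a i) (λ m → ^-derivative j k (λ m′ → φ (m ∙ m′))) ⟩
          ∫ (a i) (λ m → c * (∫a′ (a ^ j) at k of (λ m′ → φ (m ∙ m′))))
            ≡⟨ ∫-* c (a i) _ ⟩
          c * ∫ (a i) (λ m → ∫a′ (a ^ j) at k of (λ m′ → φ (m ∙ m′)))
            ≡⟨ cong (c *_) (∫-∑ (a i) (antidiagonal k) _) ⟩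
          c * ∑ᵈ k (λ l k → ∫ (a i) (λ m → fromℕ (suc l) * ∫ (a (suc l)) (λ m′ →
            ∫ ((a ^ j) k) (λ m″ → φ (m ∙ (m′ ∙ m″))))))
            ≡⟨ cong (c *_) (∑ᵈ-cong k (exchange i)) ⟩
          c * ∑ᵈ k (F i) ∎
        -- Once the degree of the differentiated factor is the outer index, the inner sum is the
        -- convolution of a with aʲ, which is the next power.
        collect : ∀ l k → ∑ᵈ k (λ i → F i l) ≡
          fromℕ (suc l) * ∫ (a (suc l)) (λ m → ∫ ((a ^ suc j) k) (λ m′ → φ (m ∙ m′)))
        collect l k = begin
          ∑ᵈ k (λ i → F i l)
            ≡⟨ *-distribˡ-∑ (fromℕ (suc l)) (antidiagonal k) _ ⟨
          fromℕ (suc l) * ∑ᵈ k (λ i k → ∫ (a (suc l)) (λ m′ → ∫ (a i) (λ m →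
            ∫ ((a ^ j) k) (λ m″ → φ (m′ ∙ (m ∙ m″))))))
            ≡⟨ cong (fromℕ (suc l) *_) (∫-∑ (a (suc l)) (antidiagonal k) _) ⟨
          fromℕ (suc l) * ∫ (a (suc l)) (λ m′ → ∑ᵈ k (λ i k → ∫ (a i) (λ m →
            ∫ ((a ^ j) k) (λ m″ → φ (m′ ∙ (m ∙ m″))))))
            ≡⟨ cong (fromℕ (suc l) *_) (∫-cong (a (suc l)) (λ m′ →
                 ∫-⊛ a (a ^ j) k (λ m → φ (m′ ∙ m)))) ⟨
          fromℕ (suc l) * ∫ (a (suc l)) (λ m → ∫ ((a ^ suc j) k) (λ m′ → φ (m ∙ m′))) ∎

    ∫-exp : ∀ n φ → ∫ (expˢ a n) φ ≡ ∑ (upTo (suc n)) (λ j → 1/ j ! * ∫ ((a ^ j) n) φ)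
    ∫-exp n φ = trans
      (∑-concat-map (λ j → scale (1/ j !) ((a ^ j) n)) (upTo (suc n)) (λ (q , m) → q * φ m))
      (∑-cong (upTo (suc n)) (λ j → ∫-scale (1/ j !) ((a ^ j) n) φ))

    -- The exponential series is cut off at the degree in question. Differentiation in degree n
    -- meets coefficients of several degrees k ≤ n under the common cutoff n; the additional powers
    -- vanish.
    ∫-exp-≤ : ∀ {n N} φ → n ℕ.≤ N →
      ∑ (upTo (suc N)) (λ j → 1/ j ! * ∫ ((a ^ j) n) φ) ≡ ∫ (expˢ a n) φ
    ∫-exp-≤ {n} φ n≤N = go (ℕ.≤⇒≤′ n≤N)
      where
      t : ℕ → ℚ
      t j = 1/ j ! * ∫ ((a ^ j) n) φ
      go : ∀ {N} → n ℕ.≤′ N → ∑ (upTo (suc N)) t ≡ ∫ (expˢ a n) φ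
      go ℕ.≤′-refl = sym (∫-exp n φ)
      go {suc N} (ℕ.≤′-step n≤′N) = begin
        ∑ (upTo (2 ℕ.+ N)) t
          ≡⟨ cong (λ js → ∑ js t) (List.upTo-∷ʳ (suc N)) ⟨
        ∑ (upTo (suc N) ++ [ suc N ]) t
          ≡⟨ ∑-++ (upTo (suc N)) [ suc N ] t ⟩
        ∑ (upTo (suc N)) t + (t (suc N) + 0ℚ)
          ≡⟨ cong₂ (λ x y → x + (y + 0ℚ)) (go n≤′N)
               (trans (cong (1/ suc N ! *_) (^-vanishes (suc N) φ (ℕ.s≤s (ℕ.≤′⇒≤ n≤′N))))
               (*-zeroʳ (1/ suc N !))) ⟩
        ∫ (expˢ a n) φ + 0ℚ
          ≡⟨ ℚ.+-identityʳ (∫ (expˢ a n) φ) ⟩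
        ∫ (expˢ a n) φ ∎

    -- (exp a)′ = a′ exp a
    exp-derivative : ∀ n φ → fromℕ (suc n) * ∫ (expˢ a (suc n)) φ ≡ ∫a′ (expˢ a) at n of φ
    exp-derivative n φ = begin
      N * ∫ (expˢ a (suc n)) φ
        ≡⟨ cong (N *_) (∫-exp (suc n) φ) ⟩
      -- The zeroth power has no coefficient in degree n + 1. Dropping it shifts j by one, and the
      -- factor j + 1 from the derivative turns 1/(j + 1)! into 1/j!.
      N * (1/ 0 ! * 0ℚ + ∑ (applyUpTo suc (suc n)) u)
        ≡⟨ cong (N *_) (trans (cong (_+ ∑ (applyUpTo suc (suc n)) u) (*-zeroʳ (1/ 0 !))) (ℚ.+-identityˡ (∑ (applyUpTo suc (suc n)) u))) ⟩
      N * ∑ (applyUpTo suc (suc n)) u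
        ≡⟨ cong (λ js → N * ∑ js u) (List.map-upTo suc (suc n)) ⟨
      N * ∑ (map suc (upTo (suc n))) u
        ≡⟨ cong (N *_) (∑-map suc (upTo (suc n)) u) ⟩
      N * ∑ (upTo (suc n)) (u ∘ suc)
        ≡⟨ *-distribˡ-∑ N (upTo (suc n)) (u ∘ suc) ⟩
      ∑ (upTo (suc n)) (λ j → N * u (suc j))
        ≡⟨ ∑-cong (upTo (suc n)) step ⟩
      ∑ (upTo (suc n)) (λ j → ∑ᵈ n (λ i k → G i k j))
        ≡⟨ ∑-swap (upTo (suc n)) (antidiagonal n) (λ j (i , k) → G i k j) ⟩
      ∑ᵈ n (λ i k → ∑ (upTo (suc n)) (G i k))
        ≡⟨ ∑ᵈ-cong-+ n collect ⟩
      ∫a′ (expˢ a) at n of φ ∎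
      where
      N = fromℕ (suc n)
      u : ℕ → ℚ
      u j = 1/ j ! * ∫ ((a ^ j) (suc n)) φ
      G : ℕ → ℕ → ℕ → ℚ
      G i k j = fromℕ (suc i) * ∫ (a (suc i)) (λ m → 1/ j ! * ∫ ((a ^ j) k) (λ m′ → φ (m ∙ m′)))
      step : ∀ j → N * u (suc j) ≡ ∑ᵈ n (λ i k → G i k j)
      step j = begin
        N * (1/ suc j ! * X)
          ≡⟨ ring 3 (λ n v x → n :* (v :* x) := v :* (n :* x)) refl N (1/ suc j !) X ⟩
        1/ suc j ! * (N * X)
          ≡⟨ cong (1/ suc j ! *_) (^-derivative j n φ) ⟩
        1/ suc j ! * (fromℕ (suc j) * Y)
          ≡⟨ ring 3 (λ v s y → v :* (s :* y) := s :* v :* y) refl (1/ suc j !) (fromℕ (suc j)) Y ⟩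
        fromℕ (suc j) * 1/ suc j ! * Y
          ≡⟨ cong (_* Y) (1/!-suc j) ⟩
        1/ j ! * Y
          ≡⟨ *-distribˡ-∑ (1/ j !) (antidiagonal n) _ ⟩
        ∑ᵈ n (λ i k → 1/ j ! * (fromℕ (suc i) * Z i k))
          ≡⟨ ∑ᵈ-cong n (λ i k → trans
               (ring 3 (λ v s z → v :* (s :* z) := s :* (v :* z)) refl (1/ j !) (fromℕ (suc i)) (Z i k))
               (cong (fromℕ (suc i) *_) (sym (∫-* (1/ j !) (a (suc i)) _)))) ⟩
        ∑ᵈ n (λ i k → G i k j) ∎
        where
        X = ∫ ((a ^ suc j) (suc n)) φ
        Y = ∫a′ (a ^ j) at n of φ
        Z : ℕ → ℕ → ℚ
        Z i k = ∫ (a (suc i)) (λ m → ∫ ((a ^ j) k) (λ m′ → φ (m ∙ m′)))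
      collect : ∀ i k → i ℕ.+ k ≡ n → ∑ (upTo (suc n)) (G i k) ≡
        fromℕ (suc i) * ∫ (a (suc i)) (λ m → ∫ (expˢ a k) (λ m′ → φ (m ∙ m′)))
      collect i k eq = begin
        ∑ (upTo (suc n)) (G i k)
          ≡⟨ *-distribˡ-∑ (fromℕ (suc i)) (upTo (suc n)) _ ⟨
        fromℕ (suc i) * ∑ (upTo (suc n)) (λ j → ∫ (a (suc i)) (λ m → 1/ j ! * ∫ ((a ^ j) k) (λ m′ → φ (m ∙ m′))))
          ≡⟨ cong (fromℕ (suc i) *_) (∫-∑ (a (suc i)) (upTo (suc n)) _) ⟨
        fromℕ (suc i) * ∫ (a (suc i)) (λ m → ∑ (upTo (suc n)) (λ j → 1/ j ! * ∫ ((a ^ j) k) (λ m′ → φ (m ∙ m′))))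
          ≡⟨ cong (fromℕ (suc i) *_) (∫-cong (a (suc i)) (λ m →
               ∫-exp-≤ (λ m′ → φ (m ∙ m′)) (subst (k ℕ.≤_) eq (ℕ.m≤n+m k i)))) ⟩
        fromℕ (suc i) * ∫ (a (suc i)) (λ m → ∫ (expˢ a k) (λ m′ → φ (m ∙ m′))) ∎

-- Sets of vertices

_∋_ : Subset n → Fin n → Set
S ∋ v = lookup S v ≡ inside

subset-ext : {S R : Subset n} → (∀ v → lookup S v ≡ lookup R v) → S ≡ R
subset-ext {S = S} {R} eq =
  trans (sym (Vec.tabulate∘lookup S)) (trans (Vec.tabulate-cong eq) (Vec.tabulate∘lookup R))

does⇒ : ∀ {a} {A : Set a} (d : Dec A) → does d ≡ true → A
does⇒ (yes x) _ = x

⇔⇒≡ : ∀ {x y} → (x ≡ true → y ≡ true) → (y ≡ true → x ≡ true) → x ≡ y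
⇔⇒≡ {false} {false} f g = refl
⇔⇒≡ {false} {true}  f g = g refl
⇔⇒≡ {true}  {false} f g = sym (f refl)
⇔⇒≡ {true}  {true}  f g = refl

lookup-∁ : (S : Subset n) (v : Fin n) → lookup (∁ S) v ≡ not (lookup S v)
lookup-∁ S v = Vec.lookup-map v not S

element-∋ : (S : Subset n) (i : Fin ∣ S ∣) → S ∋ element S i
element-∋ (outside Vec.∷ S) i       = element-∋ S i
element-∋ (inside  Vec.∷ S) zero    = refl
element-∋ (inside  Vec.∷ S) (suc i) = element-∋ S i

-- The side of v together with its rank there. Being inverse to `unindex`, it gives both
-- surjectivity onto S and injectivity of `element`, as well as the vertex bijection of
-- `separated-≅`.
index : (S : Subset n) (v : Fin n) → Fin ∣ S ∣ ⊎ Fin ∣ ∁ S ∣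
index (inside  Vec.∷ S) zero    = inj₁ zero
index (outside Vec.∷ S) zero    = inj₂ zero
index (inside  Vec.∷ S) (suc v) = Sum.map₁ suc (index S v)
index (outside Vec.∷ S) (suc v) = Sum.map₂ suc (index S v)

unindex : (S : Subset n) → Fin ∣ S ∣ ⊎ Fin ∣ ∁ S ∣ → Fin n
unindex S = Sum.[ element S , element (∁ S) ]

unindex-index : (S : Subset n) (v : Fin n) → unindex S (index S v) ≡ v
unindex-index (inside  Vec.∷ S) zero    = refl
unindex-index (outside Vec.∷ S) zero    = refl
unindex-index (inside  Vec.∷ S) (suc v) with index S v | unindex-index S v
... | inj₁ i | eq = cong suc eq
... | inj₂ j | eq = cong suc eq
unindex-index (outside Vec.∷ S) (suc v) with index S v | unindex-index S v
... | inj₁ i | eq = cong suc eq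
... | inj₂ j | eq = cong suc eq

index-unindex : (S : Subset n) (x : Fin ∣ S ∣ ⊎ Fin ∣ ∁ S ∣) → index S (unindex S x) ≡ x
index-unindex (inside  Vec.∷ S) (inj₁ zero)    = refl
index-unindex (inside  Vec.∷ S) (inj₁ (suc i)) = cong (Sum.map₁ suc) (index-unindex S (inj₁ i))
index-unindex (inside  Vec.∷ S) (inj₂ j)       = cong (Sum.map₁ suc) (index-unindex S (inj₂ j))
index-unindex (outside Vec.∷ S) (inj₁ i)       = cong (Sum.map₂ suc) (index-unindex S (inj₁ i))
index-unindex (outside Vec.∷ S) (inj₂ zero)    = refl
index-unindex (outside Vec.∷ S) (inj₂ (suc j)) = cong (Sum.map₂ suc) (index-unindex S (inj₂ j))

element-surjective : (S : Subset n) (v : Fin n) → S ∋ v → ∃ λ i → element S i ≡ v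
element-surjective S v S∋v with index S v | unindex-index S v
... | inj₁ i | eq = i , eq
... | inj₂ j | eq = contradiction
  (trans (cong not (sym S∋v)) (trans (sym (lookup-∁ S v)) (trans (cong (lookup (∁ S)) (sym eq)) (element-∋ (∁ S) j))))
  (λ ())

element-injective : (S : Subset n) {i j : Fin ∣ S ∣} → element S i ≡ element S j → i ≡ j
element-injective S {i} {j} eq = inj₁-injective (begin
  inj₁ i                ≡⟨ index-unindex S (inj₁ i) ⟨
  index S (element S i) ≡⟨ cong (index S) eq ⟩
  index S (element S j) ≡⟨ index-unindex S (inj₁ j) ⟩
  inj₁ j                ∎)

-- The image of a set under `element R`, by recursion on R so that orders and enumerations can be
-- compared clause by clause.
embed : (R : Subset n) → Subset ∣ R ∣ → Subset n
embed Vec.[]            Vec.[]      = Vec.[]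
embed (outside Vec.∷ R) X           = outside Vec.∷ embed R X
embed (inside  Vec.∷ R) (x Vec.∷ X) = x Vec.∷ embed R X

∣embed∣ : (R : Subset n) (X : Subset ∣ R ∣) → ∣ embed R X ∣ ≡ ∣ X ∣
∣embed∣ Vec.[]            Vec.[]            = refl
∣embed∣ (outside Vec.∷ R) X                 = ∣embed∣ R X
∣embed∣ (inside  Vec.∷ R) (outside Vec.∷ X) = ∣embed∣ R X
∣embed∣ (inside  Vec.∷ R) (inside  Vec.∷ X) = cong suc (∣embed∣ R X)

-- Increasing enumerations compose. The two orders are only propositionally equal, hence the `cast`;
-- its equation is an irrelevant argument, so each recursive call may supply its own proof.
element-embed : (R : Subset n) (X : Subset ∣ R ∣) .(eq : ∣ embed R X ∣ ≡ ∣ X ∣) (i : Fin ∣ embed R X ∣) →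
  element (embed R X) i ≡ element R (element X (cast eq i))
element-embed Vec.[]            Vec.[]            eq ()
element-embed (outside Vec.∷ R) X                 eq i       = cong suc (element-embed R X eq i)
element-embed (inside  Vec.∷ R) (outside Vec.∷ X) eq i       = cong suc (element-embed R X eq i)
element-embed (inside  Vec.∷ R) (inside  Vec.∷ X) eq zero    = refl
element-embed (inside  Vec.∷ R) (inside  Vec.∷ X) eq (suc i) =
  cong suc (element-embed R X (cong ℕ.pred eq) i)

lookup-embed : (R : Subset n) (X : Subset ∣ R ∣) (i : Fin ∣ R ∣) →
  lookup (embed R X) (element R i) ≡ lookup X i
lookup-embed (outside Vec.∷ R) X           i       = lookup-embed R X i
lookup-embed (inside  Vec.∷ R) (x Vec.∷ X) zero    = refl
lookup-embed (inside  Vec.∷ R) (x Vec.∷ X) (suc i) = lookup-embed R X i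

embed-⊆ : (R : Subset n) (X : Subset ∣ R ∣) (v : Fin n) → embed R X ∋ v → R ∋ v
embed-⊆ (outside Vec.∷ R) X           (suc v) p = embed-⊆ R X v p
embed-⊆ (inside  Vec.∷ R) (x Vec.∷ X) zero    p = refl
embed-⊆ (inside  Vec.∷ R) (x Vec.∷ X) (suc v) p = embed-⊆ R X v p

embed-injective : (R : Subset n) {X Y : Subset ∣ R ∣} → embed R X ≡ embed R Y → X ≡ Y
embed-injective R {X} {Y} eq = subset-ext (λ i →
  trans (sym (lookup-embed R X i)) (trans (cong (λ Z → lookup Z (element R i)) eq) (lookup-embed R Y i)))

-- Isomorphisms

≈ᴳ⇒≅ : (G H : Graph n) → G ≈ᴳ H → G ≅ H
≈ᴳ⇒≅ G H eq = ↔-refl , eq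

induced-embed : (G : Graph n) (R : Subset n) (X : Subset ∣ R ∣) →
  induced G (embed R X) ≅ induced (induced G R) X
induced-embed G R X =
  mk↔ₛ′ (cast eq) (cast (sym eq)) (λ i → trans (cast-trans (sym eq) eq i) (cast-is-id refl i))
    (λ i → trans (cast-trans eq (sym eq) i) (cast-is-id refl i)) ,
  λ i j → cong₂ (adj G) (element-embed R X eq i) (element-embed R X eq j)
  where eq = ∣embed∣ R X

≅-sym : {G : Graph m} {H : Graph n} → G ≅ H → H ≅ G
≅-sym {G = G} {H} (π , iso) = ↔-sym π , λ u v →
  trans (cong₂ (adj H) (sym (Inverse.strictlyInverseˡ π u)) (sym (Inverse.strictlyInverseˡ π v)))
        (sym (iso (Inverse.from π u) (Inverse.from π v)))

-- Sets of vertices without edges to their complement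

Separated : Subset n → Graph n → Set
Separated S G = ∀ u v → T (adj G u v) → lookup S u ≡ lookup S v

separated? : (S : Subset n) (G : Graph n) → Dec (Separated S G)
separated? S G = all? (λ u → all? (λ v → T? (adj G u v) →-dec lookup S u ≟ᵇ lookup S v))

module _ (S : Subset n) {G : Graph n} (sep : Separated S G) where

  separated-∁ : Separated (∁ S) G
  separated-∁ u v uv = trans (lookup-∁ S u) (trans (cong not (sep u v uv)) (sym (lookup-∁ S v)))

  separated-reachable : ∀ {u v} → Reachable G u v → lookup S u ≡ lookup S v
  separated-reachable ε        = refl
  separated-reachable (e ◅ es) = trans (sep _ _ e) (separated-reachable es)

  nonadjacent : ∀ u v → S ∋ u → ∁ S ∋ v → adj G u v ≡ false
  nonadjacent u v S∋u ∁S∋v with adj G u v in eq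
  ... | false = refl
  ... | true  = contradiction
    (trans (cong not (trans (sym S∋u) (sep u v (subst T (sym eq) _)))) (trans (sym (lookup-∁ S v)) ∁S∋v))
    (λ ())

  -- A path that starts in S cannot leave it, so each of its vertices has an index in S.
  reachable-induced : ∀ i j → Reachable G (element S i) (element S j) → Reachable (induced G S) i j
  reachable-induced i j = go refl
    where
    go : ∀ {u i} → element S i ≡ u → Reachable G u (element S j) → Reachable (induced G S) i j
    go {i = i} eq ε with refl ← element-injective S eq = ε
    go {i = i} refl (_◅_ {j = w} e es)
      with k , refl ← element-surjective S w (trans (sym (sep _ _ e)) (element-∋ S i)) = e ◅ go refl es

  separated-≅ : (induced G S ⊕ induced G (∁ S)) ≅ G
  separated-≅ = ↔-trans +↔⊎ (mk↔ₛ′ (unindex S) (index S) (unindex-index S) (index-unindex S)) , iso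
    where
    iso : ∀ x y → adj (induced G S ⊕ induced G (∁ S)) x y ≡
      adj G (unindex S (splitAt ∣ S ∣ x)) (unindex S (splitAt ∣ S ∣ y))
    iso x y with splitAt ∣ S ∣ x | splitAt ∣ S ∣ y
    ... | inj₁ i | inj₁ j = refl
    ... | inj₂ i | inj₂ j = refl
    ... | inj₁ i | inj₂ j = sym (nonadjacent (element S i) (element (∁ S) j) (element-∋ S i) (element-∋ (∁ S) j))
    ... | inj₂ i | inj₁ j = sym (trans (adj-sym G (element (∁ S) i) (element S j))
      (nonadjacent (element S j) (element (∁ S) i) (element-∋ S j) (element-∋ (∁ S) i)))

reachable-element : (G : Graph n) (S : Subset n) {i j : Fin ∣ S ∣} →
  Reachable (induced G S) i j → Reachable G (element S i) (element S j)
reachable-element G S = gmap (element S) id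

reachable-sym : (G : Graph n) {u v : Fin n} → Reachable G u v → Reachable G v u
reachable-sym G ε        = ε
reachable-sym G (_◅_ {i = u} {j = w} e es) = reachable-sym G es ◅◅ subst T (adj-sym G u w) e ◅ ε

-- Components

lookup-componentOf : (G : Graph n) (u v : Fin n) → lookup (componentOf G u) v ≡ does (reachable? G u v)
lookup-componentOf G u v = Vec.lookup∘tabulate _ v

module _ (G : Graph n) {u v : Fin n} where

  ∋⇒reachable : componentOf G u ∋ v → Reachable G u v
  ∋⇒reachable p = does⇒ (reachable? G u v) (trans (sym (lookup-componentOf G u v)) p)

  reachable⇒∋ : Reachable G u v → componentOf G u ∋ v
  reachable⇒∋ r = trans (lookup-componentOf G u v) (dec-true (reachable? G u v) r)

  componentOf-≡ : Reachable G u v → componentOf G u ≡ componentOf G v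
  componentOf-≡ r = subset-ext (λ w → begin
    lookup (componentOf G u) w ≡⟨ lookup-componentOf G u w ⟩
    does (reachable? G u w)    ≡⟨ does-⇔ (mk⇔ (reachable-sym G r ◅◅_) (r ◅◅_)) (reachable? G u w) (reachable? G v w) ⟩
    does (reachable? G v w)    ≡⟨ lookup-componentOf G v w ⟨
    lookup (componentOf G v) w ∎)

∈-componentSets⁺ : (G : Graph n) (v : Fin n) → componentOf G v ∈ componentSets G
∈-componentSets⁺ G v = ∈-deduplicate⁺ (Vec.≡-dec _≟ᵇ_) (∈-map⁺ (componentOf G) (∈-allFin v))

∈-componentSets⁻ : (G : Graph n) {X : Subset n} → X ∈ componentSets G → ∃ λ v → X ≡ componentOf G v
∈-componentSets⁻ {n} G X∈
  with v , _ , eq ← ∈-map⁻ (componentOf G) (∈-deduplicate⁻ (Vec.≡-dec _≟ᵇ_) (map (componentOf G) (allFin n)) X∈)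
  = v , eq

componentSets-unique : (G : Graph n) → Unique (componentSets G)
componentSets-unique {n} G = UniqueDec.deduplicate-! (Vec.≡-dec _≟ᵇ_) (map (componentOf G) (allFin n))

componentOf-separated : (G : Graph n) (R : Subset n) → Separated R G → (i : Fin ∣ R ∣) →
  componentOf G (element R i) ≡ embed R (componentOf (induced G R) i)
componentOf-separated G R sep i = subset-ext (λ v → ⇔⇒≡ (to v) (from v))
  where
  to : ∀ v → componentOf G (element R i) ∋ v → embed R (componentOf (induced G R) i) ∋ v
  to v p with r ← ∋⇒reachable G p
    with j , refl ← element-surjective R v (trans (sym (separated-reachable R {G} sep r)) (element-∋ R i))
    = trans (lookup-embed R _ j) (reachable⇒∋ (induced G R) (reachable-induced R {G} sep i j r))
  from : ∀ v → embed R (componentOf (induced G R) i) ∋ v → componentOf G (element R i) ∋ v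
  from v p with j , refl ← element-surjective R v (embed-⊆ R _ v p)
    = reachable⇒∋ G (reachable-element G R (∋⇒reachable (induced G R) (trans (sym (lookup-embed R _ j)) p)))

module _ (G : Graph n) (v : Fin n) where

  separated-componentOf : Separated (componentOf G v) G
  separated-componentOf u w uw = begin
    lookup (componentOf G v) u ≡⟨ lookup-componentOf G v u ⟩
    does (reachable? G v u)    ≡⟨ does-⇔ (mk⇔ (_◅◅ uw ◅ ε) (_◅◅ subst T (adj-sym G u w) uw ◅ ε)) (reachable? G v u) (reachable? G v w) ⟩
    does (reachable? G v w)    ≡⟨ lookup-componentOf G v w ⟨
    lookup (componentOf G v) w ∎

-- The component of the vertex zero

-- Says that S with `zero` added is the component of `zero` (see `Splits⇔`), but through one
-- condition on edges, which `∑-separated` absorbs, and one condition on the induced graph alone.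
Splits : Graph (suc n) → Subset n → Set
Splits G S = Separated (inside Vec.∷ S) G × Connected (induced G (inside Vec.∷ S))

splits? : (G : Graph (suc n)) (S : Subset n) → Dec (Splits G S)
splits? G S = separated? (inside Vec.∷ S) G ×-dec connected? (induced G (inside Vec.∷ S))

module _ (G : Graph (suc n)) where

  splits⇒component : ∀ {S} → Splits G S → inside Vec.∷ S ≡ componentOf G zero
  splits⇒component {S} (sep , _ , conn) = subset-ext (λ v → ⇔⇒≡ (to v) (from v))
    where
    S⁺ = inside Vec.∷ S
    to : ∀ v → S⁺ ∋ v → componentOf G zero ∋ v
    to v p with i , refl ← element-surjective S⁺ v p = reachable⇒∋ G (reachable-element G S⁺ (conn zero i))
    from : ∀ v → componentOf G zero ∋ v → S⁺ ∋ v
    from v p = sym (separated-reachable S⁺ {G} sep {zero} {v} (∋⇒reachable G p))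

  component⇒splits : ∀ {S} → inside Vec.∷ S ≡ componentOf G zero → Splits G S
  component⇒splits {S} eq = sep , _ , λ i j →
    reachable-induced S⁺ {G} sep i j (reachable-sym G (reach i) ◅◅ reach j)
    where
    S⁺ = inside Vec.∷ S
    sep : Separated S⁺ G
    sep = subst (λ R → Separated R G) (sym eq) (separated-componentOf G zero)
    reach : ∀ i → Reachable G zero (element S⁺ i)
    reach i = ∋⇒reachable G (subst (_∋ element S⁺ i) eq (element-∋ S⁺ i))

  Splits⇔ : ∀ S → Splits G S ⇔ (Vec.tail (componentOf G zero) ≡ S)
  Splits⇔ S = mk⇔ (sym ∘ cong Vec.tail ∘ splits⇒component) (component⇒splits ∘ to)
    where
    to : Vec.tail (componentOf G zero) ≡ S → inside Vec.∷ S ≡ componentOf G zero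
    to refl = cong (Vec._∷ Vec.tail (componentOf G zero)) (sym (reachable⇒∋ G {zero} {zero} ε))

  -- Exactly one S splits G, namely the component of `zero` without `zero`; summing over S thus
  -- inserts a factor 1.
  ∑-splits : ∀ x → ∑ (subsets n) (λ S → 𝟙 (splits? G S) * x) ≡ x
  ∑-splits x = trans
    (∑-cong (subsets n) (λ S → cong (_* x) (𝟙-cong (Splits⇔ S) (splits? G S) (Vec.≡-dec _≟ᵇ_ (Vec.tail (componentOf G zero)) S))))
    (∑-select (Vec.≡-dec _≟ᵇ_) (subsets-unique n) (subsets-complete (Vec.tail (componentOf G zero))) (λ _ → x))

  module _ {S : Subset n} (split : Splits G S) where

    private
      S⁺ R : Subset (suc n)
      S⁺ = inside Vec.∷ S
      R  = outside Vec.∷ ∁ S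

    -- Both lists are free of repetitions and have the same members. A permutation suffices, since
    -- it is applied only to sums and to `All`.
    componentSets-split : componentSets G ↭ S⁺ ∷ map (embed R) (componentSets (induced G R))
    componentSets-split = ∼bag⇒↭ (unique∧set⇒bag (componentSets-unique G)
      -- `S⁺` contains `zero`, while a set embedded along `R` does not.
      (All.map⁺ (All.universal (λ X ()) _) ∷ Unique.map⁺ (embed-injective R) (componentSets-unique (induced G R)))
      (mk⇔ to from))
      where
      sepR : Separated R G
      sepR = separated-∁ S⁺ {G} (proj₁ split)
      to : ∀ {X} → X ∈ componentSets G → X ∈ S⁺ ∷ map (embed R) (componentSets (induced G R))
      to X∈ with v , refl ← ∈-componentSets⁻ G X∈ with index S⁺ v | unindex-index S⁺ v
      ... | inj₁ i | refl = here (sym (trans (splits⇒component split) (componentOf-≡ G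
        (∋⇒reachable G (subst (_∋ v) (splits⇒component split) (element-∋ S⁺ i))))))
      ... | inj₂ j | refl = there (subst (_∈ map (embed R) (componentSets (induced G R)))
        (sym (componentOf-separated G R sepR j)) (∈-map⁺ (embed R) (∈-componentSets⁺ (induced G R) j)))
      from : ∀ {X} → X ∈ S⁺ ∷ map (embed R) (componentSets (induced G R)) → X ∈ componentSets G
      from (here refl) = subst (_∈ componentSets G) (sym (splits⇒component split)) (∈-componentSets⁺ G zero)
      from (there X∈) with Y , Y∈ , refl ← ∈-map⁻ (embed R) X∈
        with j , refl ← ∈-componentSets⁻ (induced G R) Y∈
        = subst (_∈ componentSets G) (componentOf-separated G R sepR j) (∈-componentSets⁺ G (element R j))

-- Invariance of components, weights and values

module _ {G H : Graph n} (G≈H : G ≈ᴳ H) where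

  ≈ᴳ⇒connected : Connected G → Connected H
  ≈ᴳ⇒connected (n≢0 , conn) = n≢0 , λ u v → gmap id (λ {x} {y} → subst T (G≈H x y)) (conn u v)

  ≈ᴳ⇒componentOf : ∀ v → componentOf G v ≡ componentOf H v
  ≈ᴳ⇒componentOf v = Vec.tabulate-cong (λ u → does-⇔
    (mk⇔ (gmap id (λ {x} {y} → subst T (G≈H x y))) (gmap id (λ {x} {y} → subst T (sym (G≈H x y)))))
    (reachable? G v u) (reachable? H v u))

h₀-∑ : ∀ ω (G : Graph n) → h₀ ω G ≡ ∑ (componentSets G) (ω ∘ ∣_∣)
h₀-∑ ω G = cong sumℚ (sym (List.map-∘ (componentSets G)))

h₀-≈ᴳ : ∀ ω {G H : Graph n} → G ≈ᴳ H → h₀ ω G ≡ h₀ ω H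
h₀-≈ᴳ {n} ω {G} {H} G≈H = begin
  h₀ ω G                          ≡⟨ h₀-∑ ω G ⟩
  ∑ (componentSets G) (ω ∘ ∣_∣)   ≡⟨ cong (λ Cs → ∑ (deduplicate (Vec.≡-dec _≟ᵇ_) Cs) (ω ∘ ∣_∣))
                                       (List.map-cong (≈ᴳ⇒componentOf G≈H) (allFin n)) ⟩
  ∑ (componentSets H) (ω ∘ ∣_∣)   ≡⟨ h₀-∑ ω H ⟨
  h₀ ω H                          ∎

≅⇒values : (f : Fin s → AdditiveFunction) {G : Graph m} {H : Graph n} → G ≅ H → values f G ≡ values f H
≅⇒values f {G} {H} G≅H = Vec.tabulate-cong (λ i → AdditiveFunction.invariant (f i) G H G≅H)

∑-↭ : {A : Set} {xs ys : List A} (f : A → ℚ) → xs ↭ ys → ∑ xs f ≡ ∑ ys f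
∑-↭ f xs↭ys = foldr-commMonoid (setoid ℚ) ℚ.+-0-isCommutativeMonoid (↭⇒↭ₛ (↭-map⁺ f xs↭ys))

-- Weights, values and properties split along the component of zero

module _ (G : Graph (suc n)) {S : Subset n} (split : Splits G S) where

  private
    S⁺ R : Subset (suc n)
    S⁺ = inside Vec.∷ S
    R  = outside Vec.∷ ∁ S

  h₀-split : ∀ ω → h₀ ω G ≡ ω (suc ∣ S ∣) + h₀ ω (induced G R)
  h₀-split ω = begin
    h₀ ω G
      ≡⟨ h₀-∑ ω G ⟩
    ∑ (componentSets G) (ω ∘ ∣_∣)
      ≡⟨ ∑-↭ (ω ∘ ∣_∣) (componentSets-split G split) ⟩
    ω (suc ∣ S ∣) + ∑ (map (embed R) (componentSets (induced G R))) (ω ∘ ∣_∣)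
      ≡⟨ +-congˡ (ω (suc ∣ S ∣)) (trans
           (∑-map (embed R) (componentSets (induced G R)) (ω ∘ ∣_∣))
           (∑-cong (componentSets (induced G R)) (λ X → cong ω (∣embed∣ R X)))) ⟩
    ω (suc ∣ S ∣) + ∑ (componentSets (induced G R)) (ω ∘ ∣_∣)
      ≡⟨ +-congˡ (ω (suc ∣ S ∣)) (h₀-∑ ω (induced G R)) ⟨
    ω (suc ∣ S ∣) + h₀ ω (induced G R) ∎

  values-split : (f : Fin s → AdditiveFunction) →
    values f G ≡ Vec.zipWith ℤ._+_ (values f (induced G S⁺)) (values f (induced G R))
  values-split f = begin
    values f G
      ≡⟨ ≅⇒values f (separated-≅ S⁺ {G} (proj₁ split)) ⟨
    values f (induced G S⁺ ⊕ induced G R)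
      ≡⟨ Vec.tabulate-cong (λ i → AdditiveFunction.additive (f i) (induced G S⁺) (induced G R)) ⟩
    tabulate (λ i → value (f i) (induced G S⁺) ℤ.+ value (f i) (induced G R))
      ≡⟨ zipWith-tabulate (λ i → value (f i) (induced G S⁺)) (λ i → value (f i) (induced G R)) ⟨
    Vec.zipWith ℤ._+_ (values f (induced G S⁺)) (values f (induced G R)) ∎
    where
    zipWith-tabulate : ∀ {s} (a b : Fin s → ℤ) →
      Vec.zipWith ℤ._+_ (tabulate a) (tabulate b) ≡ tabulate (λ i → a i ℤ.+ b i)
    zipWith-tabulate {zero}  a b = refl
    zipWith-tabulate {suc s} a b = cong (a zero ℤ.+ b zero Vec.∷_) (zipWith-tabulate (a ∘ suc) (b ∘ suc))

  -- Homogeneity replaces G and the rest by their components, which `componentSets-split` matches,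
  -- with `S⁺` itself as one of those of G. The remaining ones are induced in one step from G but in
  -- two steps from the rest, hence the transport along `induced-embed`.
  holds-split : (P : GraphProperty ℓ) → Homogeneous P →
    holds P G ⇔ (holds P (induced G S⁺) × holds P (induced G R))
  holds-split P hom = mk⇔ to from
    where
    transport : ∀ {m n} {G : Graph m} {H : Graph n} → G ≅ H → holds P G → holds P H
    transport {G = G} {H} = GraphProperty.invariant P G H
    to : holds P G → holds P (induced G S⁺) × holds P (induced G R)
    to PG with All-resp-↭ (componentSets-split G split) (All.map⁻ (Equivalence.to (hom G) PG))
    ... | PS ∷ PRs = PS , Equivalence.from (hom (induced G R)) (All.map⁺
      (All.map (λ {X} → transport (induced-embed G R X)) (All.map⁻ PRs)))
    from : holds P (induced G S⁺) × holds P (induced G R) → holds P G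
    from (PS , PR) = Equivalence.from (hom G) (All.map⁺ (All-resp-↭ (↭-sym (componentSets-split G split))
      (PS ∷ All.map⁺ (All.map (λ {X} → transport (≅-sym {G = induced G (embed R X)} {H = induced (induced G R) X} (induced-embed G R X)))
        (All.map⁻ (Equivalence.to (hom (induced G R)) PR))))))

-- Graphs separated by a given set

restrict : (R : Subset n) → Subset n → Subset ∣ R ∣
restrict R X = tabulate (lookup X ∘ element R)

_⊑_ : Subset n → Subset n → Set
X ⊑ R = ∀ v → X ∋ v → R ∋ v

_⊑?_ : (X R : Subset n) → Dec (X ⊑ R)
X ⊑? R = all? (λ v → lookup X v ≟ᵇ inside →-dec lookup R v ≟ᵇ inside)

-- Restriction to R is a bijection from the sets contained in R onto all subsets of `Fin ∣ R ∣`; the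
-- indicator keeps one representative of each restriction.
∑-restrict : (R : Subset n) (f : Subset ∣ R ∣ → ℚ) →
  ∑ (subsets n) (λ X → 𝟙 (X ⊑? R) * f (restrict R X)) ≡ ∑ (subsets ∣ R ∣) f
∑-restrict Vec.[] f = cong (_+ 0ℚ) (ℚ.*-identityˡ (f Vec.[]))
∑-restrict {suc n} (outside Vec.∷ R) f = begin
  ∑ (subsets (suc n)) (λ X → 𝟙 (X ⊑? (outside Vec.∷ R)) * f (restrict (outside Vec.∷ R) X))
    ≡⟨ ∑-cartesianProductWith Vec._∷_ (outside ∷ inside ∷ []) (subsets n) _ ⟩
  Z + (∑ (subsets n) (λ X → 𝟙 ((inside Vec.∷ X) ⊑? (outside Vec.∷ R)) * f (restrict R X)) + 0ℚ)
    ≡⟨ cong₂ (λ x y → x + (y + 0ℚ))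
         (∑-cong (subsets n) (λ X → cong (_* f (restrict R X)) (𝟙-cong
           (mk⇔ (λ X⊑R v → X⊑R (suc v)) (λ { X⊑R (suc v) → X⊑R v }))
           ((outside Vec.∷ X) ⊑? (outside Vec.∷ R)) (X ⊑? R))))
         (trans (∑-cong (subsets n) (λ X → *-zeroˡ (f (restrict R X)))) (∑-zero (subsets n))) ⟩
  ∑ (subsets n) (λ X → 𝟙 (X ⊑? R) * f (restrict R X)) + (0ℚ + 0ℚ)
    ≡⟨ ℚ.+-identityʳ _ ⟩
  ∑ (subsets n) (λ X → 𝟙 (X ⊑? R) * f (restrict R X))
    ≡⟨ ∑-restrict R f ⟩
  ∑ (subsets ∣ R ∣) f ∎
  where Z = ∑ (subsets n) (λ X → 𝟙 ((outside Vec.∷ X) ⊑? (outside Vec.∷ R)) * f (restrict R X))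
∑-restrict {suc n} (inside Vec.∷ R) f = begin
  ∑ (subsets (suc n)) (λ X → 𝟙 (X ⊑? (inside Vec.∷ R)) * f (restrict (inside Vec.∷ R) X))
    ≡⟨ ∑-cartesianProductWith Vec._∷_ (outside ∷ inside ∷ []) (subsets n) _ ⟩
  ∑ (outside ∷ inside ∷ []) (λ b → ∑ (subsets n) (λ X → 𝟙 ((b Vec.∷ X) ⊑? (inside Vec.∷ R)) * f (b Vec.∷ restrict R X)))
    ≡⟨ ∑-cong (outside ∷ inside ∷ []) (λ b → trans
         (∑-cong (subsets n) (λ X → cong (_* f (b Vec.∷ restrict R X)) (𝟙-cong
           (mk⇔ (λ X⊑R v → X⊑R (suc v)) (λ { X⊑R zero _ → refl ; X⊑R (suc v) → X⊑R v }))
           ((b Vec.∷ X) ⊑? (inside Vec.∷ R)) (X ⊑? R))))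
         (∑-restrict R (λ X → f (b Vec.∷ X)))) ⟩
  ∑ (outside ∷ inside ∷ []) (λ b → ∑ (subsets ∣ R ∣) (λ X → f (b Vec.∷ X)))
    ≡⟨ ∑-cartesianProductWith Vec._∷_ (outside ∷ inside ∷ []) (subsets ∣ R ∣) f ⟨
  ∑ (subsets (suc ∣ R ∣)) f ∎

-- The old vertices that lie on the same side as a new vertex with membership bit b; this treats
-- both cases of `∑-separated` alike.
side : Bool → Subset n → Subset n
side inside  S = S
side outside S = ∁ S

lookup-side : ∀ b (S : Subset n) v → lookup (side b S) v ≡ inside ⇔ b ≡ lookup S v
lookup-side b S v = mk⇔ (to b) (from b)
  where
  to : ∀ b → side b S ∋ v → b ≡ lookup S v
  to inside  p = sym p
  to outside p = not-injective (trans (sym p) (lookup-∁ S v))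
  from : ∀ b → b ≡ lookup S v → side b S ∋ v
  from inside  p = sym p
  from outside p = trans (lookup-∁ S v) (cong not (sym p))

separated-extend : ∀ b (S X : Subset n) (G : Graph n) →
  Separated (b Vec.∷ S) (extend X G) ⇔ (X ⊑ side b S × Separated S G)
separated-extend b S X G = mk⇔ to from
  where
  to : Separated (b Vec.∷ S) (extend X G) → X ⊑ side b S × Separated S G
  to sep = (λ v X∋v → Equivalence.from (lookup-side b S v) (sep zero (suc v) (Equivalence.from T-≡ X∋v))) ,
    λ u v → sep (suc u) (suc v)
  from : X ⊑ side b S × Separated S G → Separated (b Vec.∷ S) (extend X G)
  from (X⊑ , sep) zero    (suc v) e = Equivalence.to (lookup-side b S v) (X⊑ v (Equivalence.to T-≡ e))
  from (X⊑ , sep) (suc u) zero    e = sym (Equivalence.to (lookup-side b S u) (X⊑ u (Equivalence.to T-≡ e)))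
  from (X⊑ , sep) (suc u) (suc v) e = sep u v e

-- Separation forces the neighbours of the new vertex onto its own side, so the choice of a
-- neighbourhood becomes the choice of a subset of that side.
∑-extend-separated : ∀ b (S : Subset n) (Φ : Subset ∣ side b S ∣ → Graph n → ℚ) →
  ∑ (subsets n) (λ X → ∑ (graphs n) (λ G →
    𝟙 (separated? (b Vec.∷ S) (extend X G)) * Φ (restrict (side b S) X) G))
  ≡ ∑ (subsets ∣ side b S ∣) (λ Y → ∑ (graphs n) (λ G → 𝟙 (separated? S G) * Φ Y G))
∑-extend-separated {n} b S Φ = trans (∑-cong (subsets n) step)
  (∑-restrict (side b S) (λ Y → ∑ (graphs n) (λ G → 𝟙 (separated? S G) * Φ Y G)))
  where
  step : ∀ X → ∑ (graphs n) (λ G → 𝟙 (separated? (b Vec.∷ S) (extend X G)) * Φ (restrict (side b S) X) G)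
    ≡ 𝟙 (X ⊑? side b S) * ∑ (graphs n) (λ G → 𝟙 (separated? S G) * Φ (restrict (side b S) X) G)
  step X = trans
    (∑-cong (graphs n) (λ G → trans
      (cong (_* Φ (restrict (side b S) X) G) (trans
        (𝟙-cong (separated-extend b S X G) (separated? (b Vec.∷ S) (extend X G)) (X ⊑? side b S ×-dec separated? S G))
        (𝟙-× (X ⊑? side b S) (separated? S G))))
      (ℚ.*-assoc (𝟙 (X ⊑? side b S)) (𝟙 (separated? S G)) (Φ (restrict (side b S) X) G))))
    (sym (*-distribˡ-∑ (𝟙 (X ⊑? side b S)) (graphs n) (λ G → 𝟙 (separated? S G) * Φ (restrict (side b S) X) G)))

extend-cong : (X : Subset n) {G H : Graph n} → G ≈ᴳ H → extend X G ≈ᴳ extend X H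
extend-cong X G≈H zero    zero    = refl
extend-cong X G≈H zero    (suc v) = refl
extend-cong X G≈H (suc u) zero    = refl
extend-cong X G≈H (suc u) (suc v) = G≈H u v

induced-extend : {S : Subset n} (X : Subset n) (G : Graph n) →
  induced (extend X G) (inside Vec.∷ S) ≈ᴳ extend (restrict S X) (induced G S)
induced-extend X G zero    zero    = refl
induced-extend X G zero    (suc v) = sym (Vec.lookup∘tabulate _ v)
induced-extend X G (suc u) zero    = sym (Vec.lookup∘tabulate _ u)
induced-extend X G (suc u) (suc v) = refl

-- A graph separated by S amounts to a pair of graphs on S and on its complement.
∑-separated : (S : Subset n) (F : Graph ∣ S ∣ → Graph ∣ ∁ S ∣ → ℚ) →
  (∀ {H H′ K K′} → H ≈ᴳ H′ → K ≈ᴳ K′ → F H K ≡ F H′ K′) →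
  ∑ (graphs n) (λ G → 𝟙 (separated? S G) * F (induced G S) (induced G (∁ S)))
  ≡ ∑ (graphs ∣ S ∣) (λ H → ∑ (graphs ∣ ∁ S ∣) (λ K → F H K))
∑-separated Vec.[] F F-cong =
  -- Even graphs without vertices are identified only up to `≈ᴳ`.
  cong (_+ 0ℚ) (trans (ℚ.*-identityˡ _) (trans (F-cong (λ ()) (λ ())) (sym (ℚ.+-identityʳ _))))
∑-separated {suc n} (inside Vec.∷ S) F F-cong = begin
  ∑ (graphs (suc n)) (λ G → 𝟙 (separated? S⁺ G) * F (induced G S⁺) (induced G (∁ S⁺)))
    ≡⟨ ∑-cartesianProductWith extend (subsets n) (graphs n) _ ⟩
  ∑ (subsets n) (λ X → ∑ (graphs n) (λ G → 𝟙 (separated? S⁺ (extend X G)) *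
    F (induced (extend X G) S⁺) (induced (extend X G) (∁ S⁺))))
    ≡⟨ ∑-cong (subsets n) (λ X → ∑-cong (graphs n) (λ G → cong (𝟙 (separated? S⁺ (extend X G)) *_)
         (F-cong (induced-extend X G) (λ _ _ → refl)))) ⟩
  ∑ (subsets n) (λ X → ∑ (graphs n) (λ G → 𝟙 (separated? S⁺ (extend X G)) *
    F (extend (restrict S X) (induced G S)) (induced G (∁ S))))
    ≡⟨ ∑-extend-separated inside S (λ Y G → F (extend Y (induced G S)) (induced G (∁ S))) ⟩
  ∑ (subsets ∣ S ∣) (λ Y → ∑ (graphs n) (λ G → 𝟙 (separated? S G) *
    F (extend Y (induced G S)) (induced G (∁ S))))
    -- The induction hypothesis is applied to the weight into which the neighbourhood Y of the new
    -- vertex has been built.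
    ≡⟨ ∑-cong (subsets ∣ S ∣) (λ Y → ∑-separated S (λ H K → F (extend Y H) K)
         (λ H≈H′ → F-cong (extend-cong Y H≈H′))) ⟩
  ∑ (subsets ∣ S ∣) (λ Y → ∑ (graphs ∣ S ∣) (λ H → ∑ (graphs ∣ ∁ S ∣) (λ K → F (extend Y H) K)))
    ≡⟨ ∑-cartesianProductWith extend (subsets ∣ S ∣) (graphs ∣ S ∣) _ ⟨
  ∑ (graphs (suc ∣ S ∣)) (λ H → ∑ (graphs ∣ ∁ S ∣) (λ K → F H K)) ∎
  where S⁺ = inside Vec.∷ S
∑-separated {suc n} (outside Vec.∷ S) F F-cong = begin
  ∑ (graphs (suc n)) (λ G → 𝟙 (separated? S⁺ G) * F (induced G S⁺) (induced G (∁ S⁺)))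
    ≡⟨ ∑-cartesianProductWith extend (subsets n) (graphs n) _ ⟩
  ∑ (subsets n) (λ X → ∑ (graphs n) (λ G → 𝟙 (separated? S⁺ (extend X G)) *
    F (induced (extend X G) S⁺) (induced (extend X G) (∁ S⁺))))
    ≡⟨ ∑-cong (subsets n) (λ X → ∑-cong (graphs n) (λ G → cong (𝟙 (separated? S⁺ (extend X G)) *_)
         (F-cong (λ _ _ → refl) (induced-extend X G)))) ⟩
  ∑ (subsets n) (λ X → ∑ (graphs n) (λ G → 𝟙 (separated? S⁺ (extend X G)) *
    F (induced G S) (extend (restrict (∁ S) X) (induced G (∁ S)))))
    ≡⟨ ∑-extend-separated outside S (λ Y G → F (induced G S) (extend Y (induced G (∁ S)))) ⟩
  ∑ (subsets ∣ ∁ S ∣) (λ Y → ∑ (graphs n) (λ G → 𝟙 (separated? S G) *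
    F (induced G S) (extend Y (induced G (∁ S)))))
    ≡⟨ ∑-cong (subsets ∣ ∁ S ∣) (λ Y → ∑-separated S (λ H K → F H (extend Y K))
         (λ H≈H′ K≈K′ → F-cong H≈H′ (extend-cong Y K≈K′))) ⟩
  ∑ (subsets ∣ ∁ S ∣) (λ Y → ∑ (graphs ∣ S ∣) (λ H → ∑ (graphs ∣ ∁ S ∣) (λ K → F H (extend Y K))))
    ≡⟨ ∑-swap (subsets ∣ ∁ S ∣) (graphs ∣ S ∣) _ ⟩
  ∑ (graphs ∣ S ∣) (λ H → ∑ (subsets ∣ ∁ S ∣) (λ Y → ∑ (graphs ∣ ∁ S ∣) (λ K → F H (extend Y K))))
    ≡⟨ ∑-cong (graphs ∣ S ∣) (λ H → ∑-cartesianProductWith extend (subsets ∣ ∁ S ∣) (graphs ∣ ∁ S ∣) (F H)) ⟨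
  ∑ (graphs ∣ S ∣) (λ H → ∑ (graphs (suc ∣ ∁ S ∣)) (λ K → F H K)) ∎
  where S⁺ = outside Vec.∷ S

-- Monomials

·ᶻ-comm : ∀ α β → α ·ᶻ β ≡ β ·ᶻ α
·ᶻ-comm []      []      = refl
·ᶻ-comm []      (b ∷ β) = refl
·ᶻ-comm (a ∷ α) []      = refl
·ᶻ-comm (a ∷ α) (b ∷ β) = cong₂ _∷_ (ℕ.+-comm a b) (·ᶻ-comm α β)

·ᶻ-leftComm : ∀ α β γ → α ·ᶻ (β ·ᶻ γ) ≡ β ·ᶻ (α ·ᶻ γ)
·ᶻ-leftComm []      β       γ       = refl
·ᶻ-leftComm (a ∷ α) []      γ       = refl
·ᶻ-leftComm (a ∷ α) (b ∷ β) []      = ·ᶻ-comm (a ∷ α) (b ∷ β)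
·ᶻ-leftComm (a ∷ α) (b ∷ β) (c ∷ γ) = cong₂ _∷_
  (trans (sym (ℕ.+-assoc a b c)) (trans (cong (ℕ._+ c) (ℕ.+-comm a b)) (ℕ.+-assoc b a c)))
  (·ᶻ-leftComm α β γ)

·ʸᶻ-leftComm : ∀ {s} (x y z : YZ s) → x ·ʸᶻ (y ·ʸᶻ z) ≡ y ·ʸᶻ (x ·ʸᶻ z)
·ʸᶻ-leftComm (k , α) (l , β) (m , γ) = cong₂ _,_
  (trans (sym (Vec.zipWith-assoc ℤ.+-assoc k l m))
    (trans (cong (λ j → Vec.zipWith ℤ._+_ j m) (Vec.zipWith-comm ℤ.+-comm k l)) (Vec.zipWith-assoc ℤ.+-assoc l k m)))
  (·ᶻ-leftComm α β γ)

weight-·ᶻ : ∀ ω α β → weight ω (α ·ᶻ β) ≡ weight ω α + weight ω β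
weight-·ᶻ ω []      β       = sym (ℚ.+-identityˡ (weight ω β))
weight-·ᶻ ω (a ∷ α) []      = sym (ℚ.+-identityʳ (weight ω (a ∷ α)))
weight-·ᶻ ω (a ∷ α) (b ∷ β) = trans
  (cong₂ (λ x y → ω 1 * x + y) (fromℕ-+ a b) (weight-·ᶻ (ω ∘ suc) α β))
  (ring 5 (λ w a b x y → w :* (a :+ b) :+ (x :+ y) := w :* a :+ x :+ (w :* b :+ y)) refl
    (ω 1) (fromℕ a) (fromℕ b) (weight (ω ∘ suc) α) (weight (ω ∘ suc) β))

weight-z : ∀ ω i → weight ω (z (suc i)) ≡ ω (suc i)
weight-z ω zero    = trans (ℚ.+-identityʳ (ω 1 * 1ℚ)) (ℚ.*-identityʳ (ω 1))
weight-z ω (suc i) = trans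
  (trans (cong (_+ weight (ω ∘ suc) (z (suc i))) (*-zeroʳ (ω 1))) (ℚ.+-identityˡ (weight (ω ∘ suc) (z (suc i)))))
  (weight-z (ω ∘ suc) i)

infixl 6 _⊞_

_⊞_ : ∀ {s} → YZ^ℚ s → YZ^ℚ s → YZ^ℚ s
(k , μ) ⊞ (l , ν) = Vec.zipWith ℤ._+_ k l , μ + ν

substitute : ∀ {s} → (ℕ → ℚ) → YZ s → YZ^ℚ s
substitute ω (k , α) = k , weight ω α

substitute-homo : ∀ {s} ω (x y : YZ s) → substitute ω (x ·ʸᶻ y) ≡ substitute ω x ⊞ substitute ω y
substitute-homo ω (k , α) (l , β) = cong (_ ,_) (weight-·ᶻ ω α β)

-- Counting graphs against a test function

module _ {ι ℓ} {I : Set ι} (𝒫 : I → GraphProperty ℓ) (hom : ∀ i → Homogeneous (𝒫 i))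
         (sat? : ∀ {n} (G : Graph n) → Dec (Satisfies 𝒫 G))
         {s} (f : Fin s → AdditiveFunction) (ω : ℕ → ℚ) where

  stats : ∀ {n} → Graph n → YZ^ℚ s
  stats G = values f G , h₀ ω G

  ∑ᴳ : ℕ → (YZ^ℚ s → ℚ) → ℚ
  ∑ᴳ n φ = ∑ (graphs n) (λ G → 𝟙 (sat? G) * φ (stats G))

  connSat? : ∀ {n} (G : Graph n) → Dec (Connected G × Satisfies 𝒫 G)
  connSat? G = connected? G ×-dec sat? G

  satisfies-≈ᴳ : ∀ {n} (G H : Graph n) → G ≈ᴳ H → Satisfies 𝒫 G → Satisfies 𝒫 H
  satisfies-≈ᴳ G H G≈H sat i = GraphProperty.invariant (𝒫 i) G H (≈ᴳ⇒≅ G H G≈H) (sat i)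

  stats-split : ∀ {n} (G : Graph (suc n)) {S} → Splits G S →
    stats G ≡ (values f (induced G (inside Vec.∷ S)) , ω (suc ∣ S ∣)) ⊞ stats (induced G (outside Vec.∷ ∁ S))
  stats-split G split = cong₂ _,_ (values-split G split f) (h₀-split G split ω)

  satisfies-split : ∀ {n} (G : Graph (suc n)) {S} → Splits G S →
    Satisfies 𝒫 G ⇔ (Satisfies 𝒫 (induced G (inside Vec.∷ S)) × Satisfies 𝒫 (induced G (outside Vec.∷ ∁ S)))
  satisfies-split G split = mk⇔
    (λ sat → (λ i → proj₁ (Equivalence.to (holds-split G split (𝒫 i) (hom i)) (sat i))) ,
             (λ i → proj₂ (Equivalence.to (holds-split G split (𝒫 i) (hom i)) (sat i))))
    (λ (satS , satR) i → Equivalence.from (holds-split G split (𝒫 i) (hom i)) (satS i , satR i))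

  -- The component of the vertex zero has order i + 1, the other components
  -- together have order j.
  byComponent : (YZ^ℚ s → ℚ) → ℕ → ℕ → ℚ
  byComponent φ i j = ∑ (graphs (suc i)) (λ H →
    𝟙 (connSat? H) * ∑ᴳ j (λ x → φ ((values f H , ω (suc i)) ⊞ x)))

  -- Each graph is charged to its unique splitting set S. For fixed S the summand is the separation
  -- indicator times a function of the two induced graphs, which `∑-separated` lets vary
  -- independently.
  ∑ᴳ-suc : ∀ n φ → ∑ᴳ (suc n) φ ≡ ∑ (subsets n) (λ S → byComponent φ ∣ S ∣ ∣ ∁ S ∣)
  ∑ᴳ-suc n φ = begin
    ∑ (graphs (suc n)) w
      ≡⟨ ∑-cong (graphs (suc n)) (λ G → ∑-splits G (w G)) ⟨
    ∑ (graphs (suc n)) (λ G → ∑ (subsets n) (λ S → 𝟙 (splits? G S) * w G))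
      ≡⟨ ∑-swap (graphs (suc n)) (subsets n) (λ G S → 𝟙 (splits? G S) * w G) ⟩
    ∑ (subsets n) (λ S → ∑ (graphs (suc n)) (λ G → 𝟙 (splits? G S) * w G))
      ≡⟨ ∑-cong (subsets n) forSet ⟩
    ∑ (subsets n) (λ S → byComponent φ ∣ S ∣ ∣ ∁ S ∣) ∎
    where
    w : Graph (suc n) → ℚ
    w G = 𝟙 (sat? G) * φ (stats G)
    forSet : ∀ S → ∑ (graphs (suc n)) (λ G → 𝟙 (splits? G S) * w G) ≡ byComponent φ ∣ S ∣ ∣ ∁ S ∣
    forSet S = begin
      ∑ (graphs (suc n)) (λ G → 𝟙 (splits? G S) * w G)
        ≡⟨ ∑-cong (graphs (suc n)) factor ⟩
      ∑ (graphs (suc n)) (λ G → 𝟙 (separated? S⁺ G) * F (induced G S⁺) (induced G (∁ S⁺)))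
        ≡⟨ ∑-separated S⁺ F F-cong ⟩
      ∑ (graphs ∣ S⁺ ∣) (λ H → ∑ (graphs ∣ ∁ S ∣) (F H))
        ≡⟨ ∑-cong (graphs ∣ S⁺ ∣) (λ H → *-distribˡ-∑ (𝟙 (connSat? H)) (graphs ∣ ∁ S ∣) (W H)) ⟨
      byComponent φ ∣ S ∣ ∣ ∁ S ∣ ∎
      where
      S⁺ : Subset (suc n)
      S⁺ = inside Vec.∷ S
      W : Graph ∣ S⁺ ∣ → Graph ∣ ∁ S ∣ → ℚ
      W H K = 𝟙 (sat? K) * φ ((values f H , ω (suc ∣ S ∣)) ⊞ stats K)
      F : Graph ∣ S⁺ ∣ → Graph ∣ ∁ S ∣ → ℚ
      F H K = 𝟙 (connSat? H) * W H K
      F-cong : ∀ {H H′ K K′} → H ≈ᴳ H′ → K ≈ᴳ K′ → F H K ≡ F H′ K′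
      F-cong {H} {H′} {K} {K′} H≈ K≈ = cong₂ _*_
        (𝟙-cong (mk⇔ (λ (c , x) → ≈ᴳ⇒connected {G = H} {H = H′} H≈ c , satisfies-≈ᴳ H H′ H≈ x)
                     (λ (c , x) → ≈ᴳ⇒connected {G = H′} {H = H} H≈′ c , satisfies-≈ᴳ H′ H H≈′ x)) (connSat? H) (connSat? H′))
        (cong₂ _*_ (𝟙-cong (mk⇔ (satisfies-≈ᴳ K K′ K≈) (satisfies-≈ᴳ K′ K K≈′)) (sat? K) (sat? K′))
          (cong₂ (λ x y → φ ((x , ω (suc ∣ S ∣)) ⊞ y)) (≅⇒values f (≈ᴳ⇒≅ H H′ H≈))
            (cong₂ _,_ (≅⇒values f (≈ᴳ⇒≅ K K′ K≈)) (h₀-≈ᴳ ω K≈))))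
        where
        H≈′ : H′ ≈ᴳ H
        H≈′ u v = sym (H≈ u v)
        K≈′ : K′ ≈ᴳ K
        K≈′ u v = sym (K≈ u v)
      factor : ∀ G → 𝟙 (splits? G S) * w G ≡ 𝟙 (separated? S⁺ G) * F (induced G S⁺) (induced G (∁ S⁺))
      factor G = begin
        𝟙 (splits? G S) * w G
          ≡⟨ 𝟙-guard (splits? G S) (λ split → cong₂ _*_
               (trans (𝟙-cong (satisfies-split G split) (sat? G) (sat? H ×-dec sat? K)) (𝟙-× (sat? H) (sat? K)))
               (cong φ (stats-split G split))) ⟩
        𝟙 (splits? G S) * (𝟙 (sat? H) * 𝟙 (sat? K) * x)
          ≡⟨ cong (_* (𝟙 (sat? H) * 𝟙 (sat? K) * x)) (𝟙-× (separated? S⁺ G) (connected? H)) ⟩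
        𝟙 (separated? S⁺ G) * 𝟙 (connected? H) * (𝟙 (sat? H) * 𝟙 (sat? K) * x)
          ≡⟨ ring 5 (λ a b c d x → a :* b :* (c :* d :* x) := a :* (b :* c :* (d :* x))) refl
               (𝟙 (separated? S⁺ G)) (𝟙 (connected? H)) (𝟙 (sat? H)) (𝟙 (sat? K)) x ⟩
        𝟙 (separated? S⁺ G) * (𝟙 (connected? H) * 𝟙 (sat? H) * (𝟙 (sat? K) * x))
          ≡⟨ cong (λ c → 𝟙 (separated? S⁺ G) * (c * (𝟙 (sat? K) * x))) (𝟙-× (connected? H) (sat? H)) ⟨
        𝟙 (separated? S⁺ G) * F H K ∎
        where
        H = induced G S⁺
        K = induced G (∁ S⁺)
        x = φ ((values f H , ω (suc ∣ S ∣)) ⊞ stats K)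

  -- The generating function and its exponential as sums over graphs

  values≡⇔ : ∀ {n} (G : Graph n) k → HasValues f k G ⇔ (values f G ≡ k)
  values≡⇔ G k = mk⇔
    (λ eq → trans (Vec.tabulate-cong eq) (Vec.tabulate∘lookup k))
    (λ eq i → trans (sym (Vec.lookup∘tabulate (λ j → value (f j) G) i)) (cong (λ v → lookup v i) eq))

  _≟ᵛ_ : (k l : Vec ℤ s) → Dec (k ≡ l)
  _≟ᵛ_ = Vec.≡-dec ℤ._≟_

  -- Counting by value vectors and then summing over the vectors counts each connected graph once,
  -- since its vector occurs in the deduplicated list exactly once.
  ∫-g̃ : ∀ i ψ → ∫ (g̃ 𝒫 sat? f (suc i)) ψ ≡
    1/ suc i ! * ∑ (graphs (suc i)) (λ H → 𝟙 (connSat? H) * ψ (values f H , z (suc i)))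
  ∫-g̃ i ψ = begin
    ∫ (g̃ 𝒫 sat? f N) ψ
      ≡⟨ ∑-map (λ k → fromℕ (g 𝒫 sat? f N k) * 1/ N ! , (k , z N)) ks (λ (q , m) → q * ψ m) ⟩
    ∑ ks (λ k → fromℕ (g 𝒫 sat? f N k) * 1/ N ! * χ k)
      ≡⟨ ∑-cong ks (λ k → ring 3 (λ c u x → c :* u :* x := u :* (x :* c)) refl (fromℕ (g 𝒫 sat? f N k)) (1/ N !) (χ k)) ⟩
    ∑ ks (λ k → 1/ N ! * (χ k * fromℕ (g 𝒫 sat? f N k)))
      ≡⟨ *-distribˡ-∑ (1/ N !) ks (λ k → χ k * fromℕ (g 𝒫 sat? f N k)) ⟨
    1/ N ! * ∑ ks (λ k → χ k * fromℕ (g 𝒫 sat? f N k))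
      ≡⟨ cong (1/ N ! *_) (∑-cong ks expand) ⟩
    1/ N ! * ∑ ks (λ k → ∑ (graphs N) (λ H → 𝟙 (connSat? H) * (𝟙 (values f H ≟ᵛ k) * χ k)))
      ≡⟨ cong (1/ N ! *_) (∑-swap ks (graphs N) (λ k H → 𝟙 (connSat? H) * (𝟙 (values f H ≟ᵛ k) * χ k))) ⟩
    1/ N ! * ∑ (graphs N) (λ H → ∑ ks (λ k → 𝟙 (connSat? H) * (𝟙 (values f H ≟ᵛ k) * χ k)))
      ≡⟨ cong (1/ N ! *_) (∑-cong-∈ (graphs N) (λ {H} H∈ → trans
           (sym (*-distribˡ-∑ (𝟙 (connSat? H)) ks (λ k → 𝟙 (values f H ≟ᵛ k) * χ k)))
           (cong (𝟙 (connSat? H) *_) (∑-select _≟ᵛ_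
             (UniqueDec.deduplicate-! _≟ᵛ_ (map (values f) (graphs N)))
             (∈-deduplicate⁺ _≟ᵛ_ (∈-map⁺ (values f) H∈)) χ)))) ⟩
    1/ N ! * ∑ (graphs N) (λ H → 𝟙 (connSat? H) * χ (values f H)) ∎
    where
    N = suc i
    ks : List (Vec ℤ s)
    ks = valueVectors 𝒫 sat? f N
    χ : Vec ℤ s → ℚ
    χ k = ψ (k , z N)
    expand : ∀ k → χ k * fromℕ (g 𝒫 sat? f N k) ≡
      ∑ (graphs N) (λ H → 𝟙 (connSat? H) * (𝟙 (values f H ≟ᵛ k) * χ k))
    expand k = begin
      χ k * fromℕ (g 𝒫 sat? f N k)
        ≡⟨ cong (χ k *_) (fromℕ-count {n = N} (λ H → connected? H ×-dec (sat? H ×-dec hasValues? f k H))) ⟩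
      χ k * ∑ (graphs N) (λ H → 𝟙 (connected? H ×-dec (sat? H ×-dec hasValues? f k H)))
        ≡⟨ *-distribˡ-∑ (χ k) (graphs N) (λ H → 𝟙 (connected? H ×-dec (sat? H ×-dec hasValues? f k H))) ⟩
      ∑ (graphs N) (λ H → χ k * 𝟙 (connected? H ×-dec (sat? H ×-dec hasValues? f k H)))
        ≡⟨ ∑-cong (graphs N) (λ H → trans
             (cong (χ k *_) (trans
               (𝟙-cong (mk⇔ (λ (c , x , v) → (c , x) , Equivalence.to (values≡⇔ H k) v)
                            (λ ((c , x) , v) → c , x , Equivalence.from (values≡⇔ H k) v))
                 (connected? H ×-dec (sat? H ×-dec hasValues? f k H)) (connSat? H ×-dec (values f H ≟ᵛ k)))
               (𝟙-× (connSat? H) (values f H ≟ᵛ k))))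
             (ring 3 (λ x a b → x :* (a :* b) := a :* (b :* x)) refl (χ k) (𝟙 (connSat? H)) (𝟙 (values f H ≟ᵛ k)))) ⟩
      ∑ (graphs N) (λ H → 𝟙 (connSat? H) * (𝟙 (values f H ≟ᵛ k) * χ k)) ∎

  open Exponential (_·ʸᶻ_ {s}) 1ʸᶻ ·ʸᶻ-leftComm

  E : Series (YZ s)
  E = exp (g̃ 𝒫 sat? f)

  -- The empty graph is isomorphic to its disjoint union with itself, so its value v satisfies v + v
  -- = v.
  values-empty : (G : Graph 0) → values f G ≡ Vec.replicate s (+ 0)
  values-empty G = Equivalence.to (values≡⇔ G (Vec.replicate s (+ 0)))
    (λ i → trans (value-empty (f i)) (sym (Vec.lookup-replicate i (+ 0))))
    where
    value-empty : (h : AdditiveFunction) → value h G ≡ + 0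
    value-empty h = identityˡ-unique ℤ.+-0-abelianGroup (value h G) (value h G) (trans (sym (AdditiveFunction.additive h G G))
      (AdditiveFunction.invariant h (G ⊕ G) G (≈ᴳ⇒≅ (G ⊕ G) G (λ ()))))

  -- Strong induction, as removing the component of `zero` can leave any smaller order. The
  -- hypothesis is used for φ shifted by the monomial of that component.
  exp-g̃ : ∀ n φ → fromℕ (n !) * ∫ (E n) (φ ∘ substitute ω) ≡ ∑ᴳ n φ
  exp-g̃ = <-rec _ go
    where
    go : ∀ n → (∀ {k} → k ℕ.< n → ∀ φ → fromℕ (k !) * ∫ (E k) (φ ∘ substitute ω) ≡ ∑ᴳ k φ) →
      ∀ φ → fromℕ (n !) * ∫ (E n) (φ ∘ substitute ω) ≡ ∑ᴳ n φ
    go zero    rec φ = trans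
      (ring 1 (λ x → con 1ℚ :* (con 1ℚ :* con 1ℚ :* x :+ con 0ℚ) := con 1ℚ :* x :+ con 0ℚ) refl (φ (substitute ω 1ʸᶻ)))
      -- The constant term 1 counts the graph without vertices: it has no components, so homogeneity
      -- gives it every property vacuously.
      (cong (_+ 0ℚ) (cong₂ _*_ (sym (𝟙-yes (sat? _) (λ i → Equivalence.from (hom i _) [])))
        (cong φ (cong (_, 0ℚ) (sym (values-empty _))))))
    go (suc n) rec φ = begin
      fromℕ (suc n !) * X
        ≡⟨ cong (_* X) (fromℕ-* (suc n) (n !)) ⟩
      fromℕ (suc n) * fromℕ (n !) * X
        ≡⟨ ring 3 (λ a b x → a :* b :* x := b :* (a :* x)) refl (fromℕ (suc n)) (fromℕ (n !)) X ⟩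
      fromℕ (n !) * (fromℕ (suc n) * X)
        ≡⟨ cong (fromℕ (n !) *_) (exp-derivative (g̃ 𝒫 sat? f) refl n (φ ∘ substitute ω)) ⟩
      fromℕ (n !) * ∑ᵈ n (λ i k → fromℕ (suc i) * ∫ (g̃ 𝒫 sat? f (suc i)) (λ m →
        ∫ (E k) (λ m′ → φ (substitute ω (m ·ʸᶻ m′)))))
        ≡⟨ cong (fromℕ (n !) *_) (∑ᵈ-cong-+ n term) ⟩
      fromℕ (n !) * ∑ᵈ n (λ i k → 1/ i ! * 1/ k ! * byComponent φ i k)
        ≡⟨ ∑-subsets n (byComponent φ) ⟨
      ∑ (subsets n) (λ S → byComponent φ ∣ S ∣ ∣ ∁ S ∣)
        ≡⟨ ∑ᴳ-suc n φ ⟨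
      ∑ᴳ (suc n) φ ∎
      where
      X = ∫ (E (suc n)) (φ ∘ substitute ω)
      term : ∀ i k → i ℕ.+ k ≡ n →
        fromℕ (suc i) * ∫ (g̃ 𝒫 sat? f (suc i)) (λ m → ∫ (E k) (λ m′ → φ (substitute ω (m ·ʸᶻ m′))))
        ≡ 1/ i ! * 1/ k ! * byComponent φ i k
      term i k eq = begin
        fromℕ (suc i) * ∫ (g̃ 𝒫 sat? f (suc i)) (λ m → ∫ (E k) (λ m′ → φ (substitute ω (m ·ʸᶻ m′))))
          ≡⟨ cong (fromℕ (suc i) *_) (∫-cong (g̃ 𝒫 sat? f (suc i)) inner) ⟩
        fromℕ (suc i) * ∫ (g̃ 𝒫 sat? f (suc i)) (λ m → 1/ k ! * ∑ᴳ k (λ x → φ (substitute ω m ⊞ x)))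
          ≡⟨ cong (fromℕ (suc i) *_) (∫-* (1/ k !) (g̃ 𝒫 sat? f (suc i)) (λ m → ∑ᴳ k (λ x → φ (substitute ω m ⊞ x)))) ⟩
        fromℕ (suc i) * (1/ k ! * ∫ (g̃ 𝒫 sat? f (suc i)) (λ m → ∑ᴳ k (λ x → φ (substitute ω m ⊞ x))))
          ≡⟨ cong (λ y → fromℕ (suc i) * (1/ k ! * y)) (trans
               (∫-g̃ i (λ m → ∑ᴳ k (λ x → φ (substitute ω m ⊞ x))))
               (cong (1/ suc i ! *_) (∑-cong (graphs (suc i)) (λ H → cong
                 (λ q → 𝟙 (connSat? H) * ∑ᴳ k (λ x → φ ((values f H , q) ⊞ x))) (weight-z ω i))))) ⟩
        fromℕ (suc i) * (1/ k ! * (1/ suc i ! * byComponent φ i k))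
          ≡⟨ ring 4 (λ a v u x → a :* (v :* (u :* x)) := a :* u :* v :* x) refl (fromℕ (suc i)) (1/ k !) (1/ suc i !) (byComponent φ i k) ⟩
        fromℕ (suc i) * 1/ suc i ! * 1/ k ! * byComponent φ i k
          ≡⟨ cong (λ u → u * 1/ k ! * byComponent φ i k) (1/!-suc i) ⟩
        1/ i ! * 1/ k ! * byComponent φ i k ∎
        where
        inner : ∀ m → ∫ (E k) (λ m′ → φ (substitute ω (m ·ʸᶻ m′))) ≡ 1/ k ! * ∑ᴳ k (λ x → φ (substitute ω m ⊞ x))
        inner m = begin
          ∫ (E k) (λ m′ → φ (substitute ω (m ·ʸᶻ m′)))
            ≡⟨ ∫-cong (E k) (λ m′ → cong φ (substitute-homo ω m m′)) ⟩
          Y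
            ≡⟨ ℚ.*-identityˡ Y ⟨
          1ℚ * Y
            ≡⟨ cong (_* Y) (!*1/! k) ⟨
          fromℕ (k !) * 1/ k ! * Y
            ≡⟨ ring 3 (λ a u y → a :* u :* y := u :* (a :* y)) refl (fromℕ (k !)) (1/ k !) Y ⟩
          1/ k ! * (fromℕ (k !) * Y)
            ≡⟨ cong (1/ k ! *_) (rec (ℕ.s≤s (subst (k ℕ.≤_) eq (ℕ.m≤n+m k i))) (λ x → φ (substitute ω m ⊞ x))) ⟩
          1/ k ! * ∑ᴳ k (λ x → φ (substitute ω m ⊞ x)) ∎
          where Y = ∫ (E k) (λ m′ → φ (substitute ω m ⊞ substitute ω m′))

  count-∑ᴳ : ∀ n k ν → ∑ᴳ n (λ x → 𝟙 (x ≟ʸᶻ (k , ν))) ≡ fromℕ (numberOfGraphs 𝒫 sat? f ω n k ν)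
  count-∑ᴳ n k ν = begin
    ∑ (graphs n) (λ G → 𝟙 (sat? G) * 𝟙 (stats G ≟ʸᶻ (k , ν)))
      ≡⟨ ∑-cong (graphs n) (λ G → trans
           (cong (𝟙 (sat? G) *_) (𝟙-cong (mk⇔
             (λ eq → Equivalence.from (values≡⇔ G k) (cong proj₁ eq) , cong proj₂ eq)
             (λ (v , h) → cong₂ _,_ (Equivalence.to (values≡⇔ G k) v) h))
             (stats G ≟ʸᶻ (k , ν)) (hasValues? f k G ×-dec (h₀ ω G ℚ.≟ ν))))
           (sym (𝟙-× (sat? G) (hasValues? f k G ×-dec (h₀ ω G ℚ.≟ ν))))) ⟩
    ∑ (graphs n) (λ G → 𝟙 (sat? G ×-dec (hasValues? f k G ×-dec (h₀ ω G ℚ.≟ ν))))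
      ≡⟨ fromℕ-count {n = n} (λ G → sat? G ×-dec (hasValues? f k G ×-dec (h₀ ω G ℚ.≟ ν))) ⟨
    fromℕ (numberOfGraphs 𝒫 sat? f ω n k ν) ∎

theorem2 : {ι ℓ : Level} {I : Set ι} (𝒫 : I → GraphProperty ℓ) →
    (∀ i → Homogeneous (𝒫 i)) →
    (sat? : ∀ {n} (G : Graph n) → Dec (Satisfies 𝒫 G)) →
    (s : ℕ) (f : Fin s → AdditiveFunction) (ω : ℕ → ℚ)
    (T : ℕ → Vec ℤ s → ℚ → ℚ) →
    (∀ n k ν → coefficient _≟ʸᶻ_ (τ ω (exp (g̃ 𝒫 sat? f)) n) (k , ν) ≡ T n k ν * 1/ n !) →
    ∀ n k ν → T n k ν ≡ + numberOfGraphs 𝒫 sat? f ω n k ν / 1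
theorem2 𝒫 hom sat? s f ω T T-coefficient n k ν = begin
  T n k ν
    ≡⟨ ℚ.*-identityʳ (T n k ν) ⟨
  T n k ν * 1ℚ
    ≡⟨ cong (T n k ν *_) (!*1/! n) ⟨
  T n k ν * (fromℕ (n !) * 1/ n !)
    ≡⟨ ring 3 (λ t a u → t :* (a :* u) := a :* (t :* u)) refl (T n k ν) (fromℕ (n !)) (1/ n !) ⟩
  fromℕ (n !) * (T n k ν * 1/ n !)
    ≡⟨ cong (fromℕ (n !) *_) (T-coefficient n k ν) ⟨
  fromℕ (n !) * coefficient _≟ʸᶻ_ (τ ω (exp (g̃ 𝒫 sat? f)) n) (k , ν)
    ≡⟨ cong (fromℕ (n !) *_) (trans
         (coefficient-∫ _≟ʸᶻ_ (τ ω (exp (g̃ 𝒫 sat? f)) n) (k , ν))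
         (∫-linear (substitute ω) (exp (g̃ 𝒫 sat? f) n) (λ x → 𝟙 (x ≟ʸᶻ (k , ν))))) ⟩
  fromℕ (n !) * ∫ (exp (g̃ 𝒫 sat? f) n) (λ m → 𝟙 (substitute ω m ≟ʸᶻ (k , ν)))
    -- Tested against the indicator of the monomial (k , ν), the weighted sum over graphs is the
    -- required count.
    ≡⟨ exp-g̃ 𝒫 hom sat? f ω n (λ x → 𝟙 (x ≟ʸᶻ (k , ν))) ⟩
  ∑ᴳ 𝒫 hom sat? f ω n (λ x → 𝟙 (x ≟ʸᶻ (k , ν)))
    ≡⟨ count-∑ᴳ 𝒫 hom sat? f ω n k ν ⟩
  + numberOfGraphs 𝒫 sat? f ω n k ν / 1 ∎
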